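{- Let $k\geq 0$ be an integer and let $N\in\mathbb{N}$ be odd with $N>64$. Put $$f_{k,N}(x):=\frac{4}{N^2}x^{2(2k+1)}+\frac{1}{N^2}x^{2k+1}+\frac{4}{N^2}\in\mathbb{Q}[x].$$ Then the procedure "Reduction to a sum of 4 squares" described in the context, run on the input $f_{k,N}(x)$, does not stop after any finite number of steps (for any admissible choice of $\varepsilon$ in step (3)).
   Context: A polynomial in $\mathbb{Q}[x]$ is a sum of 4 squares if it equals $f_1^2+f_2^2+f_3^2+f_4^2$ with $f_i\in\mathbb{Q}[x]$ (zero allowed). $\mathbb{Q}_2$ is the field of 2-adic numbers, and $\log$ is the logarithm in base 2. Procedure "Reduction to a sum of 4 squares". Input: a square-free polynomial $f(x)=c_0+c_1x+\dots+c_dx^d\in\mathbb{Q}[x]$ with $c_d\neq 0$ and $f(t)>0$ for all $t\in\mathbb{R}$. Intended output: $h(x)\in\mathbb{Q}[x]$ such that $f(x)-h(x)^2$ is a sum of 4 or fewer squares in $\mathbb{Q}[x]$. (1) If $f(x)$ is a sum of 4 squares in $\mathbb{Q}[x]$, return $h(x):=0$. (2) Set $f_*(x)=c_d+c_{d-1}x+\dots+c_0x^d$. (3) Find a positive number $\varepsilon$ such that $\varepsilon<\inf\{f(x):x\in\mathbb{R}\}$ and $\varepsilon<\inf\{f_*(x):x\in\mathbb{R}\}$. (4) Initialize $l:=\lceil-\frac12\log\varepsilon\rceil$. (5) Repeat forever: (a) if $f(x)-2^{ -2l}$ is irreducible in $\mathbb{Q}_2[x]$, return $h(x):=2^{ -l}$;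 (b) if $f(x)-2^{ -2l}x^d$ is irreducible in $\mathbb{Q}_2[x]$, return $h(x):=2^{ -l}x^{d/2}$; (c) set $l:=l+1$. -}

module Defs where

open import Algebra.Bundles.Raw using (RawRing)
import Algebra.Definitions.RawSemiring as RawSemiringDefs
open import Data.Integer.Base as ℤ using (ℤ; +_; -[1+_])
import Data.Integer.Properties as ℤₚ
open import Data.Integer.Solver using () renaming (module +-*-Solver to ℤ-Solver)
open import Data.List.Base using (List; []; _∷_; [_]; _++_; map; foldr; replicate; applyUpTo)
open import Data.Nat.Base as ℕ using (ℕ; zero; suc; NonZero; ⌊_/2⌋; _∸_)
import Data.Nat.Properties as ℕₚ
open import Data.Nat.Induction using (<-rec)
open import Data.Product.Base using (∃; ∃₂; ∃-syntax; _×_; _,_)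
open import Data.Rational.Base as ℚ
  using (ℚ; mkℚ; 0ℚ; 1ℚ; ½; _+_; _*_; _-_; -_; ∣_∣; _/_; _≤_)
import Data.Rational.Properties as ℚₚ
import Data.Rational.Unnormalised.Base as ℚᵘ
import Data.Rational.Unnormalised.Properties as ℚᵘₚ
open import Data.Rational.Solver using (module +-*-Solver)
open import Data.Sum.Base using (_⊎_; inj₁; inj₂)
open import Level using (0ℓ)
open import Relation.Binary.Core using (Rel)
open import Relation.Binary.PropositionalEquality hiding ([_])
open import Relation.Binary.Rewriting using (HasNormalForm)
open import Relation.Nullary.Negation.Core using (¬_)

open RawSemiringDefs (RawRing.rawSemiring ℚ.+-*-rawRing) public using () renaming (_^_ to _^ℚ_)

2ℚ : ℚ
2ℚ = + 2 / 1

infix 9 2^_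

2^_ : ℤ → ℚ
2^ (+ n)      = 2ℚ ^ℚ n
2^ (-[1+ n ]) = ½ ^ℚ suc n

module IntegerEmbedding where
  int : ℤ → ℚ
  int i = i / 1

  int-+ : ∀ i j → int (i ℤ.+ j) ≡ int i + int j
  int-+ i j = ℚₚ.toℚᵘ-injective (begin
    ℚ.toℚᵘ (int (i ℤ.+ j))                   ≈⟨ ℚₚ.toℚᵘ-fromℚᵘ (ℚᵘ.mkℚᵘ (i ℤ.+ j) 0) ⟩
    ℚᵘ.mkℚᵘ (i ℤ.+ j) 0                      ≡⟨ cong (λ k → ℚᵘ.mkℚᵘ k 0) (sym (cong₂ ℤ._+_ (ℤₚ.*-identityʳ i) (ℤₚ.*-identityʳ j))) ⟩
    ℚᵘ.mkℚᵘ i 0 ℚᵘ.+ ℚᵘ.mkℚᵘ j 0             ≈⟨ ℚᵘₚ.+-cong (ℚₚ.toℚᵘ-fromℚᵘ (ℚᵘ.mkℚᵘ i 0)) (ℚₚ.toℚᵘ-fromℚᵘ (ℚᵘ.mkℚᵘ j 0)) ⟨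
    ℚ.toℚᵘ (int i) ℚᵘ.+ ℚ.toℚᵘ (int j)       ≈⟨ ℚₚ.toℚᵘ-homo-+ (int i) (int j) ⟨
    ℚ.toℚᵘ (int i + int j)                   ∎)
    where open ℚᵘₚ.≃-Reasoning

  int-* : ∀ i j → int (i ℤ.* j) ≡ int i * int j
  int-* i j = ℚₚ.toℚᵘ-injective (begin
    ℚ.toℚᵘ (int (i ℤ.* j))                   ≈⟨ ℚₚ.toℚᵘ-fromℚᵘ (ℚᵘ.mkℚᵘ (i ℤ.* j) 0) ⟩
    ℚᵘ.mkℚᵘ i 0 ℚᵘ.* ℚᵘ.mkℚᵘ j 0             ≈⟨ ℚᵘₚ.*-cong (ℚₚ.toℚᵘ-fromℚᵘ (ℚᵘ.mkℚᵘ i 0)) (ℚₚ.toℚᵘ-fromℚᵘ (ℚᵘ.mkℚᵘ j 0)) ⟨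
    ℚ.toℚᵘ (int i) ℚᵘ.* ℚ.toℚᵘ (int j)       ≈⟨ ℚₚ.toℚᵘ-homo-* (int i) (int j) ⟨
    ℚ.toℚᵘ (int i * int j)                   ∎)
    where open ℚᵘₚ.≃-Reasoning

  *-denominator : ∀ q → q * int (ℚ.↧ q) ≡ int (ℚ.↥ q)
  *-denominator q@(mkℚ n d-1 _) = ℚₚ.toℚᵘ-injective (begin
    ℚ.toℚᵘ (q * int (ℚ.↧ q))                 ≈⟨ ℚₚ.toℚᵘ-homo-* q (int (ℚ.↧ q)) ⟩
    ℚ.toℚᵘ q ℚᵘ.* ℚ.toℚᵘ (int (ℚ.↧ q))       ≈⟨ ℚᵘₚ.*-cong (ℚᵘₚ.≃-refl {ℚ.toℚᵘ q}) (ℚₚ.toℚᵘ-fromℚᵘ (ℚᵘ.mkℚᵘ (+ suc d-1) 0)) ⟩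
    ℚᵘ.mkℚᵘ n d-1 ℚᵘ.* ℚᵘ.mkℚᵘ (+ suc d-1) 0 ≈⟨ ℚᵘ.*≡* (trans (ℤₚ.*-identityʳ (n ℤ.* + suc d-1)) (cong (λ k → n ℤ.* + suc k) (sym (ℕₚ.*-identityʳ d-1)))) ⟩
    ℚᵘ.mkℚᵘ n 0                              ≈⟨ ℚₚ.toℚᵘ-fromℚᵘ (ℚᵘ.mkℚᵘ n 0) ⟨
    ℚ.toℚᵘ (int n)                           ∎)
    where open ℚᵘₚ.≃-Reasoning

open IntegerEmbedding

-- B n is the ball of radius 2⁻ⁿ around 0 for an absolute value on ℚ.
record IsBallSystem (B : ℕ → ℚ → Set) : Set where
  field
    zero-∈  : ∀ n → B n 0ℚ
    neg-∈   : ∀ {n p} → B n p → B n (- p)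
    add-∈   : ∀ {n p q} → B (suc n) p → B (suc n) q → B n (p + q)
    mul-∈   : ∀ {n p q} → B n p → B n q → B n (p * q)
    scale-∈ : ∀ q n → ∃[ m ] (∀ {p} → B m p → B n (q * p))

module Completion {B : ℕ → ℚ → Set} (isBallSystem : IsBallSystem B) where
  open IsBallSystem isBallSystem

  record Carrier : Set where
    constructor mkCauchy
    field
      seq    : ℕ → ℚ
      cauchy : ∀ n → ∃[ N ] (∀ {i j} → N ℕ.≤ i → N ℕ.≤ j → B n (seq i - seq j))

  open Carrier public

  infix 4 _≈_
  _≈_ : Rel Carrier 0ℓ
  x ≈ y = ∀ n → ∃[ N ] (∀ {i} → N ℕ.≤ i → B n (seq x i - seq y i))

  ι : ℚ → Carrier
  ι q = mkCauchy (λ _ → q) λ n → 0 , λ _ _ → subst (B n) (sym (ℚₚ.+-inverseʳ q)) (zero-∈ n)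

  private
    open +-*-Solver

    +-rearrange : ∀ a b c d → (a - c) + (b - d) ≡ (a + b) - (c + d)
    +-rearrange = solve 4 (λ a b c d → (a :- c) :+ (b :- d) := (a :+ b) :- (c :+ d)) refl

    neg-rearrange : ∀ a b → - (a - b) ≡ (- a) - (- b)
    neg-rearrange = solve 2 (λ a b → :- (a :- b) := (:- a) :- (:- b)) refl

    *-rearrange : ∀ X Y x y x′ y′ →
      (Y * (x - x′) + X * (y - y′)) + ((y - Y) * (x - x′) + (x′ - X) * (y - y′))
        ≡ x * y - x′ * y′
    *-rearrange = solve 6 (λ X Y x y x′ y′ →
      (Y :* (x :- x′) :+ X :* (y :- y′)) :+ ((y :- Y) :* (x :- x′) :+ (x′ :- X) :* (y :- y′))
        := x :* y :- x′ :* y′) refl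

  _⊕_ : Carrier → Carrier → Carrier
  x ⊕ y = mkCauchy (λ i → seq x i + seq y i) λ n →
    let (N₁ , h₁) = cauchy x (suc n)
        (N₂ , h₂) = cauchy y (suc n)
    in N₁ ℕ.⊔ N₂ , λ {i} {j} p q →
      subst (B n) (+-rearrange (seq x i) (seq y i) (seq x j) (seq y j))
        (add-∈ (h₁ (ℕₚ.m⊔n≤o⇒m≤o N₁ N₂ p) (ℕₚ.m⊔n≤o⇒m≤o N₁ N₂ q))
               (h₂ (ℕₚ.m⊔n≤o⇒n≤o N₁ N₂ p) (ℕₚ.m⊔n≤o⇒n≤o N₁ N₂ q)))

  ⊖_ : Carrier → Carrier
  ⊖ x = mkCauchy (λ i → - seq x i) λ n →
    let (N , h) = cauchy x n
    in N , λ {i} {j} p q →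
      subst (B n) (neg-rearrange (seq x i) (seq x j)) (neg-∈ (h p q))

  _⊗_ : Carrier → Carrier → Carrier
  x ⊗ y = mkCauchy (λ i → seq x i * seq y i) λ n →
    let k         = suc (suc n)
        (N₁ , h₁) = cauchy x k
        (N₂ , h₂) = cauchy y k
        X         = seq x N₁
        Y         = seq y N₂
        (m₁ , s₁) = scale-∈ Y k
        (m₂ , s₂) = scale-∈ X k
        (N₃ , h₃) = cauchy x m₁
        (N₄ , h₄) = cauchy y m₂
        N₁₂       = N₁ ℕ.⊔ N₂
        N₃₄       = N₃ ℕ.⊔ N₄
    in N₁₂ ℕ.⊔ N₃₄ , λ {i} {j} p q →
      let p₁₂ = ℕₚ.m⊔n≤o⇒m≤o N₁₂ N₃₄ p
          q₁₂ = ℕₚ.m⊔n≤o⇒m≤o N₁₂ N₃₄ q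
          p₃₄ = ℕₚ.m⊔n≤o⇒n≤o N₁₂ N₃₄ p
          q₃₄ = ℕₚ.m⊔n≤o⇒n≤o N₁₂ N₃₄ q
          p₁  = ℕₚ.m⊔n≤o⇒m≤o N₁ N₂ p₁₂
          q₁  = ℕₚ.m⊔n≤o⇒m≤o N₁ N₂ q₁₂
          p₂  = ℕₚ.m⊔n≤o⇒n≤o N₁ N₂ p₁₂
          q₂  = ℕₚ.m⊔n≤o⇒n≤o N₁ N₂ q₁₂
          p₃  = ℕₚ.m⊔n≤o⇒m≤o N₃ N₄ p₃₄
          q₃  = ℕₚ.m⊔n≤o⇒m≤o N₃ N₄ q₃₄
          p₄  = ℕₚ.m⊔n≤o⇒n≤o N₃ N₄ p₃₄
          q₄  = ℕₚ.m⊔n≤o⇒n≤o N₃ N₄ q₃₄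
      in subst (B n) (*-rearrange X Y (seq x i) (seq y i) (seq x j) (seq y j))
           (add-∈ (add-∈ (s₁ (h₃ p₃ q₃)) (s₂ (h₄ p₄ q₄)))
                  (add-∈ (mul-∈ (h₂ p₂ ℕₚ.≤-refl) (h₁ p₁ q₁))
                         (mul-∈ (h₁ q₁ ℕₚ.≤-refl) (h₂ p₂ q₂))))

  rawRing : RawRing 0ℓ 0ℓ
  rawRing = record
    { Carrier = Carrier
    ; _≈_     = _≈_
    ; _+_     = _⊕_
    ; _*_     = _⊗_
    ; -_      = ⊖_
    ; 0#      = ι 0ℚ
    ; 1#      = ι 1ℚ
    }

RealBall : ℕ → ℚ → Set
RealBall n q = ∣ q ∣ ≤ ½ ^ℚ n

module RealBallLemmas where
  0≤½ : 0ℚ ≤ ½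
  0≤½ = ℚₚ.nonNegative⁻¹ ½

  ½^-nonNeg : ∀ n → 0ℚ ≤ ½ ^ℚ n
  ½^-nonNeg zero    = ℚₚ.nonNegative⁻¹ 1ℚ
  ½^-nonNeg (suc n) = subst (_≤ ½ * ½ ^ℚ n) (ℚₚ.*-zeroʳ ½) (ℚₚ.*-monoˡ-≤-nonNeg ½ (½^-nonNeg n))

  ½^-half : ∀ n → ½ ^ℚ suc n + ½ ^ℚ suc n ≡ ½ ^ℚ n
  ½^-half n = trans (sym (ℚₚ.*-distribʳ-+ (½ ^ℚ n) ½ ½)) (ℚₚ.*-identityˡ (½ ^ℚ n))

  ½^-≤1 : ∀ n → ½ ^ℚ n ≤ 1ℚ
  ½^-≤1 zero    = ℚₚ.≤-refl
  ½^-≤1 (suc n) = ℚₚ.≤-trans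
    (subst (_≤ ½ ^ℚ suc n + ½ ^ℚ suc n) (ℚₚ.+-identityʳ (½ ^ℚ suc n))
      (ℚₚ.+-monoʳ-≤ (½ ^ℚ suc n) (½^-nonNeg (suc n))))
    (subst (_≤ 1ℚ) (sym (½^-half n)) (½^-≤1 n))

  *-mono-≤ : ∀ {p q r s} → 0ℚ ≤ q → 0ℚ ≤ r → p ≤ q → r ≤ s → p * r ≤ q * s
  *-mono-≤ {p} {q} {r} {s} 0≤q 0≤r p≤q r≤s = ℚₚ.≤-trans
    (ℚₚ.*-monoʳ-≤-nonNeg r {{ℚ.nonNegative 0≤r}} p≤q)
    (ℚₚ.*-monoˡ-≤-nonNeg q {{ℚ.nonNegative 0≤q}} r≤s)

  ∣q∣≤∣num∣ : ∀ q → ∣ q ∣ ≤ int (+ ℤ.∣ ℚ.↥ q ∣)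
  ∣q∣≤∣num∣ q@(mkℚ n d-1 _) = ℚₚ.toℚᵘ-cancel-≤ (begin
    ℚ.toℚᵘ ∣ q ∣                    ≤⟨ ℚᵘ.*≤* (ℤₚ.*-monoˡ-≤-nonNeg (+ ℤ.∣ n ∣) (ℤ.+≤+ (ℕ.s≤s ℕ.z≤n))) ⟩
    ℚᵘ.mkℚᵘ (+ ℤ.∣ n ∣) 0           ≃⟨ ℚₚ.toℚᵘ-fromℚᵘ (ℚᵘ.mkℚᵘ (+ ℤ.∣ n ∣) 0) ⟨
    ℚ.toℚᵘ (int (+ ℤ.∣ n ∣))        ∎)
    where open ℚᵘₚ.≤-Reasoning

  1≤2^ : ∀ n → 1ℚ ≤ 2ℚ ^ℚ n
  1≤2^ zero    = ℚₚ.≤-refl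
  1≤2^ (suc n) = ℚₚ.≤-trans (ℚ.*≤* (ℤ.+≤+ (ℕ.s≤s ℕ.z≤n))) (ℚₚ.*-monoˡ-≤-nonNeg 2ℚ (1≤2^ n))

  n≤2^n : ∀ n → int (+ n) ≤ 2ℚ ^ℚ n
  n≤2^n zero    = ℚₚ.nonNegative⁻¹ 1ℚ
  n≤2^n (suc n) = begin
    int (+ suc n)            ≡⟨ int-+ (+ 1) (+ n) ⟩
    1ℚ + int (+ n)           ≤⟨ ℚₚ.+-mono-≤ (1≤2^ n) (n≤2^n n) ⟩
    2ℚ ^ℚ n + 2ℚ ^ℚ n        ≡⟨ double (2ℚ ^ℚ n) ⟩
    2ℚ * 2ℚ ^ℚ n             ∎
    where
    open ℚₚ.≤-Reasoning
    double : ∀ x → x + x ≡ 2ℚ * x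
    double x = trans (sym (cong₂ _+_ (ℚₚ.*-identityˡ x) (ℚₚ.*-identityˡ x)))
                     (sym (ℚₚ.*-distribʳ-+ x 1ℚ 1ℚ))

  2^k*½^[k+n] : ∀ k n → 2ℚ ^ℚ k * ½ ^ℚ (k ℕ.+ n) ≡ ½ ^ℚ n
  2^k*½^[k+n] zero    n = ℚₚ.*-identityˡ (½ ^ℚ n)
  2^k*½^[k+n] (suc k) n = begin
    (2ℚ * x) * (½ * y)   ≡⟨ interchange 2ℚ x ½ y ⟩
    (2ℚ * ½) * (x * y)   ≡⟨ ℚₚ.*-identityˡ (x * y) ⟩
    x * y                ≡⟨ 2^k*½^[k+n] k n ⟩
    ½ ^ℚ n               ∎
    where
    open ≡-Reasoning
    open +-*-Solver
    x = 2ℚ ^ℚ k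
    y = ½ ^ℚ (k ℕ.+ n)
    interchange : ∀ a b c d → (a * b) * (c * d) ≡ (a * c) * (b * d)
    interchange = solve 4 (λ a b c d → (a :* b) :* (c :* d) := (a :* c) :* (b :* d)) refl

open RealBallLemmas

realBallSystem : IsBallSystem RealBall
realBallSystem = record
  { zero-∈  = ½^-nonNeg
  ; neg-∈   = λ {n} {p} → subst (_≤ ½ ^ℚ n) (sym (ℚₚ.∣-p∣≡∣p∣ p))
  ; add-∈   = λ {n} {p} {q} p∈ q∈ → ℚₚ.≤-trans (ℚₚ.∣p+q∣≤∣p∣+∣q∣ p q)
      (subst (∣ p ∣ + ∣ q ∣ ≤_) (½^-half n) (ℚₚ.+-mono-≤ p∈ q∈))
  ; mul-∈   = λ {n} {p} {q} p∈ q∈ →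
      subst₂ _≤_ (sym (ℚₚ.∣p*q∣≡∣p∣*∣q∣ p q)) (ℚₚ.*-identityʳ (½ ^ℚ n))
        (*-mono-≤ (½^-nonNeg n) (ℚₚ.0≤∣p∣ q) p∈ (ℚₚ.≤-trans q∈ (½^-≤1 n)))
  ; scale-∈ = λ q n → let k = ℤ.∣ ℚ.↥ q ∣ in k ℕ.+ n , λ {p} p∈ →
      subst₂ _≤_ (sym (ℚₚ.∣p*q∣≡∣p∣*∣q∣ q p)) (2^k*½^[k+n] k n)
        (*-mono-≤ (ℚₚ.≤-trans (ℚₚ.nonNegative⁻¹ 1ℚ) (1≤2^ k)) (ℚₚ.0≤∣p∣ p)
          (ℚₚ.≤-trans (∣q∣≤∣num∣ q) (n≤2^n k)) p∈)
  }

module Real = Completion realBallSystem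

ℝ : Set
ℝ = Real.Carrier

infix 4 _<ᴿ_ _≤ᴿ_

_<ᴿ_ : Rel ℝ 0ℓ
x <ᴿ y = ∃₂ λ n N → ∀ {i} → N ℕ.≤ i → Real.seq x i + ½ ^ℚ n ≤ Real.seq y i

_≤ᴿ_ : Rel ℝ 0ℓ
x ≤ᴿ y = ¬ (y <ᴿ x)

IsInfimumOfValues : {A : Set} → (A → ℝ) → ℝ → Set
IsInfimumOfValues φ m = (∀ x → m ≤ᴿ φ x) × (∀ b → (∀ x → b ≤ᴿ φ x) → b ≤ᴿ m)

-- ∣ q ∣₂ ≤ 2⁻ⁿ, i.e. q = 2ⁿ · a / b for integers a and b = 1 + 2c.
record TwoAdicBall (n : ℕ) (q : ℚ) : Set where
  constructor mkBall
  field
    a c : ℤ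
    q-eq : q * ((+ 1 ℤ.+ + 2 ℤ.* c) / 1) ≡ 2ℚ ^ℚ n * (a / 1)

module TwoAdicBallLemmas where
  odd : ℤ → ℤ
  odd c = + 1 ℤ.+ + 2 ℤ.* c

  infixl 7 _⊛_
  _⊛_ : ℤ → ℤ → ℤ
  c ⊛ c′ = c ℤ.+ c′ ℤ.+ + 2 ℤ.* (c ℤ.* c′)

  odd-⊛ : ∀ c c′ → odd (c ⊛ c′) ≡ odd c ℤ.* odd c′
  odd-⊛ = solve 2 (λ c c′ →
    con (+ 1) :+ con (+ 2) :* (c :+ c′ :+ con (+ 2) :* (c :* c′))
      := (con (+ 1) :+ con (+ 2) :* c) :* (con (+ 1) :+ con (+ 2) :* c′)) refl
    where open ℤ-Solver

  int-odd-⊛ : ∀ c c′ → int (odd (c ⊛ c′)) ≡ int (odd c) * int (odd c′)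
  int-odd-⊛ c c′ = trans (cong int (odd-⊛ c c′)) (int-* (odd c) (odd c′))

  parity : ∀ n → ∃[ h ] (n ≡ 2 ℕ.* h ⊎ n ≡ suc (2 ℕ.* h))
  parity zero = 0 , inj₁ refl
  parity (suc n) with parity n
  ... | h , inj₁ eq = h , inj₂ (cong suc eq)
  ... | h , inj₂ eq = suc h , inj₁ (trans (cong suc eq) (sym (ℕₚ.*-suc 2 h)))

  oddPart : ∀ n → 0 ℕ.< n → ∃₂ λ e c → int (+ n) ≡ 2ℚ ^ℚ e * int (odd c)
  oddPart = <-rec _ λ n rec 0<n → helper n rec 0<n (parity n)
    where
    helper : ∀ n → (∀ {m} → m ℕ.< n → 0 ℕ.< m → ∃₂ λ e c → int (+ m) ≡ 2ℚ ^ℚ e * int (odd c)) →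
             0 ℕ.< n → ∃[ h ] (n ≡ 2 ℕ.* h ⊎ n ≡ suc (2 ℕ.* h)) →
             ∃₂ λ e c → int (+ n) ≡ 2ℚ ^ℚ e * int (odd c)
    helper n rec () (zero , inj₁ refl)
    helper n rec 0<n (suc h , inj₁ refl) =
      let (e , c , eq) = rec (ℕₚ.m<m+n (suc h) ℕ.z<s) ℕ.z<s
      in suc e , c , (begin
        int (+ (2 ℕ.* suc h))        ≡⟨ cong int (ℤₚ.pos-* 2 (suc h)) ⟩
        int (+ 2 ℤ.* + suc h)        ≡⟨ int-* (+ 2) (+ suc h) ⟩
        2ℚ * int (+ suc h)           ≡⟨ cong (2ℚ *_) eq ⟩
        2ℚ * (2ℚ ^ℚ e * int (odd c)) ≡⟨ ℚₚ.*-assoc 2ℚ (2ℚ ^ℚ e) (int (odd c)) ⟨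
        2ℚ ^ℚ suc e * int (odd c)    ∎)
      where open ≡-Reasoning
    helper n rec 0<n (h , inj₂ refl) = 0 , + h ,
      trans (cong (λ i → int (+ 1 ℤ.+ i)) (ℤₚ.pos-* 2 h)) (sym (ℚₚ.*-identityˡ (int (odd (+ h)))))

  2^-+ : ∀ m n → 2ℚ ^ℚ (m ℕ.+ n) ≡ 2ℚ ^ℚ m * 2ℚ ^ℚ n
  2^-+ zero    n = sym (ℚₚ.*-identityˡ (2ℚ ^ℚ n))
  2^-+ (suc m) n = trans (cong (2ℚ *_) (2^-+ m n)) (sym (ℚₚ.*-assoc 2ℚ (2ℚ ^ℚ m) (2ℚ ^ℚ n)))

  module _ where
    open +-*-Solver
    open ≡-Reasoning

    2-neg-∈ : ∀ {n p} → TwoAdicBall n p → TwoAdicBall n (- p)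
    2-neg-∈ {n} {p} (mkBall a c eq) = mkBall (ℤ.-1ℤ ℤ.* a) c (begin
      - p * int (odd c)                    ≡⟨ ℚₚ.neg-distribˡ-* p (int (odd c)) ⟨
      - (p * int (odd c))                  ≡⟨ cong -_ eq ⟩
      - (2ℚ ^ℚ n * int a)                  ≡⟨ solve 2 (λ t a → :- (t :* a) := t :* (con (- 1ℚ) :* a)) refl (2ℚ ^ℚ n) (int a) ⟩
      2ℚ ^ℚ n * (int (ℤ.-1ℤ) * int a)      ≡⟨ cong (2ℚ ^ℚ n *_) (int-* ℤ.-1ℤ a) ⟨
      2ℚ ^ℚ n * int (ℤ.-1ℤ ℤ.* a)          ∎)

    2-add-∈ : ∀ {n p q} → TwoAdicBall (suc n) p → TwoAdicBall (suc n) q → TwoAdicBall n (p + q)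
    2-add-∈ {n} {p} {q} (mkBall a c eq) (mkBall a′ c′ eq′) =
      mkBall (+ 2 ℤ.* (a ℤ.* odd c′ ℤ.+ a′ ℤ.* odd c)) (c ⊛ c′) (begin
      (p + q) * int (odd (c ⊛ c′))         ≡⟨ cong ((p + q) *_) (int-odd-⊛ c c′) ⟩
      (p + q) * (b * b′)                   ≡⟨ solve 4 (λ p q b b′ → (p :+ q) :* (b :* b′) := (p :* b) :* b′ :+ (q :* b′) :* b) refl p q b b′ ⟩
      (p * b) * b′ + (q * b′) * b          ≡⟨ cong₂ (λ x y → x * b′ + y * b) eq eq′ ⟩
      (2ℚ * t * int a) * b′ + (2ℚ * t * int a′) * b
                                           ≡⟨ solve 6 (λ w t a a′ b b′ → (w :* t :* a) :* b′ :+ (w :* t :* a′) :* b := t :* (w :* (a :* b′ :+ a′ :* b))) refl 2ℚ t (int a) (int a′) b b′ ⟩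
      t * (2ℚ * (int a * b′ + int a′ * b)) ≡⟨ cong₂ (λ x y → t * (2ℚ * (x + y))) (int-* a (odd c′)) (int-* a′ (odd c)) ⟨
      t * (2ℚ * (int (a ℤ.* odd c′) + int (a′ ℤ.* odd c)))
                                           ≡⟨ cong (λ x → t * (2ℚ * x)) (int-+ (a ℤ.* odd c′) (a′ ℤ.* odd c)) ⟨
      t * (2ℚ * int (a ℤ.* odd c′ ℤ.+ a′ ℤ.* odd c))
                                           ≡⟨ cong (t *_) (int-* (+ 2) (a ℤ.* odd c′ ℤ.+ a′ ℤ.* odd c)) ⟨
      t * int (+ 2 ℤ.* (a ℤ.* odd c′ ℤ.+ a′ ℤ.* odd c)) ∎)
      where
      t  = 2ℚ ^ℚ n
      b  = int (odd c)
      b′ = int (odd c′)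

    2-mul-∈ : ∀ {n p q} → TwoAdicBall n p → TwoAdicBall n q → TwoAdicBall n (p * q)
    2-mul-∈ {n} {p} {q} (mkBall a c eq) (mkBall a′ c′ eq′) =
      mkBall (+ (2 ℕ.^ n) ℤ.* (a ℤ.* a′)) (c ⊛ c′) (begin
      (p * q) * int (odd (c ⊛ c′))         ≡⟨ cong ((p * q) *_) (int-odd-⊛ c c′) ⟩
      (p * q) * (b * b′)                   ≡⟨ solve 4 (λ p q b b′ → (p :* q) :* (b :* b′) := (p :* b) :* (q :* b′)) refl p q b b′ ⟩
      (p * b) * (q * b′)                   ≡⟨ cong₂ _*_ eq eq′ ⟩
      (t * int a) * (t * int a′)           ≡⟨ solve 3 (λ t a a′ → (t :* a) :* (t :* a′) := t :* (t :* (a :* a′))) refl t (int a) (int a′) ⟩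
      t * (t * (int a * int a′))           ≡⟨ cong₂ (λ x y → t * (x * y)) (int-2^ n) (int-* a a′) ⟨
      t * (int (+ (2 ℕ.^ n)) * int (a ℤ.* a′)) ≡⟨ cong (t *_) (int-* (+ (2 ℕ.^ n)) (a ℤ.* a′)) ⟨
      t * int (+ (2 ℕ.^ n) ℤ.* (a ℤ.* a′)) ∎)
      where
      t  = 2ℚ ^ℚ n
      b  = int (odd c)
      b′ = int (odd c′)
      int-2^ : ∀ n → int (+ (2 ℕ.^ n)) ≡ 2ℚ ^ℚ n
      int-2^ zero    = refl
      int-2^ (suc n) = trans (cong int (ℤₚ.pos-* 2 (2 ℕ.^ n)))
        (trans (int-* (+ 2) (+ (2 ℕ.^ n))) (cong (2ℚ *_) (int-2^ n)))

    2-scale-∈ : ∀ q n → ∃[ m ] (∀ {p} → TwoAdicBall m p → TwoAdicBall n (q * p))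
    2-scale-∈ q@(mkℚ num d-1 _) n =
      let (e , c , den-eq) = oddPart (suc d-1) ℕ.z<s
      in e ℕ.+ n , λ {p} (mkBall a c′ eq) →
        let b  = int (odd c)
            b′ = int (odd c′)
            s  = 2ℚ ^ℚ e
            t  = 2ℚ ^ℚ n
        in mkBall (num ℤ.* a) (c ⊛ c′) (begin
        (q * p) * int (odd (c ⊛ c′))       ≡⟨ cong ((q * p) *_) (int-odd-⊛ c c′) ⟩
        (q * p) * (b * b′)                 ≡⟨ solve 4 (λ q p b b′ → (q :* p) :* (b :* b′) := (q :* b) :* (p :* b′)) refl q p b b′ ⟩
        (q * b) * (p * b′)                 ≡⟨ cong ((q * b) *_) (trans eq (cong (_* int a) (2^-+ e n))) ⟩
        (q * b) * (s * t * int a)          ≡⟨ solve 5 (λ q b s t a → (q :* b) :* (s :* t :* a) := t :* (q :* (s :* b) :* a)) refl q b s t (int a) ⟩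
        t * (q * (s * b) * int a)          ≡⟨ cong (λ x → t * (q * x * int a)) den-eq ⟨
        t * (q * int (ℚ.↧ q) * int a)      ≡⟨ cong (λ x → t * (x * int a)) (*-denominator q) ⟩
        t * (int num * int a)              ≡⟨ cong (t *_) (int-* num a) ⟨
        t * int (num ℤ.* a)                ∎)

open TwoAdicBallLemmas

twoAdicBallSystem : IsBallSystem TwoAdicBall
twoAdicBallSystem = record
  { zero-∈  = λ n → mkBall (+ 0) (+ 0) (sym (ℚₚ.*-zeroʳ (2ℚ ^ℚ n)))
  ; neg-∈   = 2-neg-∈
  ; add-∈   = 2-add-∈
  ; mul-∈   = 2-mul-∈
  ; scale-∈ = 2-scale-∈
  }

module TwoAdic = Completion twoAdicBallSystem

ℚ₂ : Set
ℚ₂ = TwoAdic.Carrier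

-- a₀ ∷ a₁ ∷ … ∷ [] stands for a₀ + a₁x + …; trailing zeros are irrelevant for _≈_.
module Polynomial (R : RawRing 0ℓ 0ℓ) where
  private module R = RawRing R

  Poly : Set
  Poly = List R.Carrier

  coeff : Poly → ℕ → R.Carrier
  coeff []      _       = R.0#
  coeff (a ∷ _) zero    = a
  coeff (_ ∷ p) (suc i) = coeff p i

  infix  4 _≈ₚ_
  infixl 6 _+ₚ_
  infixl 7 _*ₚ_

  _≈ₚ_ : Rel Poly 0ℓ
  p ≈ₚ q = ∀ i → coeff p i R.≈ coeff q i

  _+ₚ_ : Poly → Poly → Poly
  []      +ₚ q       = q
  p       +ₚ []      = p
  (a ∷ p) +ₚ (b ∷ q) = (a R.+ b) ∷ (p +ₚ q)

  _*ₚ_ : Poly → Poly → Poly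
  []      *ₚ q = []
  (a ∷ p) *ₚ q = map (a R.*_) q +ₚ (R.0# ∷ p *ₚ q)

  rawRing : RawRing 0ℓ 0ℓ
  rawRing = record
    { Carrier = Poly
    ; _≈_     = _≈ₚ_
    ; _+_     = _+ₚ_
    ; _*_     = _*ₚ_
    ; -_      = map R.-_
    ; 0#      = []
    ; 1#      = [ R.1# ]
    }

  monomial : R.Carrier → ℕ → Poly
  monomial a n = replicate n R.0# ++ [ a ]

module ℚ[x] = Polynomial ℚ.+-*-rawRing
module ℚ₂[x] = Polynomial TwoAdic.rawRing

open ℚ[x] using (_+ₚ_; _*ₚ_; _≈ₚ_; monomial; coeff)

infixl 6 _-ₚ_
_-ₚ_ : ℚ[x].Poly → ℚ[x].Poly → ℚ[x].Poly
p -ₚ q = p +ₚ map -_ q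

eval : ℚ[x].Poly → ℝ → ℝ
eval p x = foldr (λ a y → Real.ι a Real.⊕ (x Real.⊗ y)) (Real.ι 0ℚ) p

SumOfFourSquares : ℚ[x].Poly → Set
SumOfFourSquares f = ∃₂ λ f₁ f₂ → ∃₂ λ f₃ f₄ →
  f ≈ₚ f₁ *ₚ f₁ +ₚ f₂ *ₚ f₂ +ₚ f₃ *ₚ f₃ +ₚ f₄ *ₚ f₄

IrreducibleOverℚ₂ : ℚ[x].Poly → Set
IrreducibleOverℚ₂ f =
  RawSemiringDefs.Irreducible (RawRing.rawSemiring ℚ₂[x].rawRing) (map TwoAdic.ι f)

-- The input is f = c₀ + … + c_d x^d of degree d, and ε is the number chosen by the procedure.
module Reduction (d : ℕ) (f : ℚ[x].Poly) (ε : ℝ) where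

  -- c_d + c_{d-1} x + … + c₀ x^d
  f⋆ : ℚ[x].Poly
  f⋆ = applyUpTo (λ i → coeff f (d ∸ i)) (suc d)

  _<inf_ : ℝ → ℚ[x].Poly → Set
  r <inf p = ∃[ m ] (IsInfimumOfValues (eval p) m × r <ᴿ m)

  Admissible : Set
  Admissible = Real.ι 0ℚ <ᴿ ε × ε <inf f × ε <inf f⋆

  -- log ε is the real number y with 2^y = ε, so n ≤ log ε means 2ⁿ ≤ ε.
  _≤logε : ℤ → Set
  n ≤logε = Real.ι (2^ n) ≤ᴿ ε

  _≥-½logε : ℤ → Set
  l ≥-½logε = (ℤ.- (+ 2 ℤ.* l)) ≤logε

  -- The ceiling of a real number is the least integer above or equal to it.
  Is⌈-½logε⌉ : ℤ → Set
  Is⌈-½logε⌉ l = l ≥-½logε × (∀ j → j ≥-½logε → l ℤ.≤ j)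

  IrreducibleA IrreducibleB : ℤ → Set
  IrreducibleA l = IrreducibleOverℚ₂ (f -ₚ monomial (2^ (ℤ.- (+ 2 ℤ.* l))) 0)
  IrreducibleB l = IrreducibleOverℚ₂ (f -ₚ monomial (2^ (ℤ.- (+ 2 ℤ.* l))) d)

  data State : Set where
    start  : State
    loop   : (l : ℤ) → State
    return : (h : ℚ[x].Poly) → State

  -- The exponent ⌊ d /2⌋ is d/2, since a polynomial that is positive on ℝ has even degree.
  infix 3 _⟶_
  data _⟶_ : Rel State 0ℓ where
    step-1   : SumOfFourSquares f → start ⟶ return []
    step-2-4 : ∀ {l} → ¬ SumOfFourSquares f → Is⌈-½logε⌉ l → start ⟶ loop l
    step-5a  : ∀ {l} → IrreducibleA l → loop l ⟶ return (monomial (2^ (ℤ.- l)) 0)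
    step-5b  : ∀ {l} → ¬ IrreducibleA l → IrreducibleB l →
               loop l ⟶ return (monomial (2^ (ℤ.- l)) ⌊ d /2⌋)
    step-5c  : ∀ {l} → ¬ IrreducibleA l → ¬ IrreducibleB l → loop l ⟶ loop (ℤ.suc l)

  -- A run stops when it reaches a state from which no step is possible.
  Stops : Set
  Stops = HasNormalForm _⟶_ start

f[_,_] : (k N : ℕ) .{{_ : NonZero N}} → ℚ[x].Poly
f[ k , N ] = monomial (+ 4 / N²) (2 ℕ.* (2 ℕ.* k ℕ.+ 1))
          +ₚ monomial (+ 1 / N²) (2 ℕ.* k ℕ.+ 1)
          +ₚ monomial (+ 4 / N²) 0
  where
  N² = N ℕ.^ 2
  instance _ = ℕₚ.m^n≢0 N 2

{-# OPTIONS --safe #-}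

-- Write m = 2k + 1 and y = xᵐ, so that N² f = 4y² + y + 4.
--
-- f is not a sum of four squares: after clearing denominators, D² N² f = ∥ Σ gⱼ xʲ ∥² with gⱼ ∈ ℤ⁴. If 2ⁿ⁺¹ ∣ ∥p∥² and
-- 2ⁿ ∣ ∥q∥² then 2ⁿ⁺¹ ∣ 2⟨p,q⟩ (the norm of ℚ₂-quaternions is a valuation). The even coefficients of D² N² f are
-- multiples of 4D², so comparing the coefficients of x²ʲ shows that every power of 2 dividing 4D² divides all ∥gⱼ∥².
-- It then divides the odd coefficient D² of xᵐ as well, hence D = 0.
--
-- Since ε < f(0) = 4/N² < 2⁻¹⁰, the loop starts with l ≥ 5. For such l the polynomials tested in step 5 are quadratic
-- in y with discriminant (N² - 63 · 2^(2l-4)) / 2^(2l-4), a square in ℚ₂ by Hensel's lemma, so they split into two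
-- factors of degree m.
module Submission where

open import Defs
open import Algebra.Bundles.Raw using (RawRing)
import Algebra.Definitions.RawSemiring as RawSemiringDefs
open import Data.Empty using (⊥-elim)
open import Data.Fin.Base using (Fin; toℕ; fromℕ<)
open import Data.Fin.Properties using (all?; toℕ-fromℕ<)
open import Data.Integer.Base as ℤ using (ℤ; +_; -[1+_])
open import Data.Integer.DivMod using (_/ℕ_; n%ℕd<d; a≡a%ℕn+[a/ℕn]*n)
import Data.Integer.Properties as ℤₚ
open import Data.Integer.Solver using () renaming (module +-*-Solver to ℤ-Solver)
open import Data.List.Base using ([]; _∷_; [_]; _++_; map)
open import Data.List.Relation.Unary.All.Properties using (++⁻)
open import Data.Nat.Base as ℕ using (ℕ; zero; suc; NonZero)
import Data.Nat.Divisibility as ℕ∣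
open import Data.Nat.Induction using (<-rec)
import Data.Nat.Properties as ℕₚ
open import Data.Product.Base using (∃-syntax; _,_; proj₁; proj₂)
import Data.Rational.Base as ℚ
import Data.Rational.Properties as ℚₚ
open import Data.Rational.Solver using () renaming (module +-*-Solver to ℚ-Solver)
import Data.Rational.Unnormalised.Base as ℚᵘ
import Data.Rational.Unnormalised.Properties as ℚᵘₚ
open import Data.Sum.Base using (inj₁; inj₂; [_,_]′)
open import Function.Base using (_∘_; case_of_)
open import Relation.Binary.Construct.Closure.ReflexiveTransitive using (Star; _◅_)
open import Relation.Binary.PropositionalEquality hiding ([_])
open import Relation.Binary.Rewriting using (IsNormalForm)
open import Relation.Nullary.Decidable using (Dec; yes; no; from-yes; _→-dec_)
open import Relation.Nullary.Negation.Core using (¬_; contradiction)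

open IntegerEmbedding
open ℚ[x] using (_+ₚ_; _*ₚ_; monomial; coeff)

-- Stopping means reaching a state without successors. So two things are needed: no `return` state
-- is reachable, and neither `start` nor a reached `loop` state is stuck. For `start` the second
-- point needs the ceiling in step 4 to exist. A ceiling cannot be computed from approximations of a
-- real number, but the goal is a negation, so the double negation of its existence is enough.
-- Elements of `ℚ₂` are Cauchy sequences of rationals, and identities between them are treated index
-- by index: an exact identity over `ℚ`, valid at every index, leaves an error term that tends to 0
-- 2-adically. All algebra thus takes place in `ℚ`. The coefficients of f read the same backwards,
-- so the polynomials tested in 5a and 5b are reversals of each other and one square root factors
-- both. Only after the reversal do the leading coefficients of the factors involve that root. Their
-- product is 4/N² - 2^(-2l), which is nonzero because N is odd, so they are invertible.

-- Norms of integer quadruples and divisibility by powers of 2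

module IntegerQuadruples where

  open import Data.Integer.Base using (_+_; _*_; _-_; _^_; ∣_∣)
  open import Data.Integer.Divisibility.Signed
  open ℤ-Solver using (solve; _:=_; _:+_; _:*_; _:-_; con; Polynomial)

  1∣ : ∀ i → + 1 ∣ i
  1∣ i = divides i (sym (ℤₚ.*-identityʳ i))

  data ℤ⁴ : Set where
    ⟨_,_,_,_⟩ : (a b c d : ℤ) → ℤ⁴

  norm : ℤ⁴ → ℤ
  norm ⟨ a , b , c , d ⟩ = a * a + b * b + c * c + d * d

  dot : ℤ⁴ → ℤ⁴ → ℤ
  dot ⟨ a , b , c , d ⟩ ⟨ a′ , b′ , c′ , d′ ⟩ = a * a′ + b * b′ + c * c′ + d * d′

  normₛ : ∀ {n} (a b c d : Polynomial n) → Polynomial n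
  normₛ a b c d = a :* a :+ b :* b :+ c :* c :+ d :* d

  -- Modulo 8 a square depends only on its root modulo 4, which leaves 256 residue quadruples to
  -- check. The modulus 4 would not do: four odd squares add up to 4 modulo 8.
  norm-even : ∀ a b c d → + 8 ∣ norm ⟨ a , b , c , d ⟩ → + 2 ∣ a
  norm-even a b c d 8∣ with residue a | residue b | residue c | residue d
    where
    residue : ∀ a → ∃[ r ] ∃[ h ] a ≡ + toℕ {4} r + h * + 4
    residue a = fromℕ< (n%ℕd<d a 4) , a /ℕ 4 ,
      trans (a≡a%ℕn+[a/ℕn]*n a 4) (cong (λ r → + r + a /ℕ 4 * + 4) (sym (toℕ-fromℕ< (n%ℕd<d a 4))))
  ... | r , h , refl | s , i , refl | t , j , refl | u , k , refl =
    ∣m∣n⇒∣m+n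
      (table r s t u (∣m+n∣n⇒∣m {m = normᵣ r s t u}
        (subst (+ 8 ∣_) (expand (+ toℕ r) (+ toℕ s) (+ toℕ t) (+ toℕ u) h i j k) 8∣)
        (∣n⇒∣m*n (q (+ toℕ r) (+ toℕ s) (+ toℕ t) (+ toℕ u) h i j k) ∣-refl)))
      (∣n⇒∣m*n h (divides (+ 2) refl))
    where
    normᵣ : (r s t u : Fin 4) → ℤ
    normᵣ r s t u = norm ⟨ + toℕ r , + toℕ s , + toℕ t , + toℕ u ⟩
    table : ∀ r s t u → + 8 ∣ normᵣ r s t u → + 2 ∣ + toℕ r
    table = from-yes (all? {4} λ r → all? {4} λ s → all? {4} λ t → all? {4} λ u →
      (+ 8 ∣? normᵣ r s t u) →-dec (+ 2 ∣? + toℕ r))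
    q : (r s t u h i j k : ℤ) → ℤ
    q r s t u h i j k = h * (r + h * + 2) + i * (s + i * + 2) + j * (t + j * + 2) + k * (u + k * + 2)
    expand : ∀ r s t u h i j k →
      norm ⟨ r + h * + 4 , s + i * + 4 , t + j * + 4 , u + k * + 4 ⟩ ≡
      norm ⟨ r , s , t , u ⟩ + q r s t u h i j k * + 8
    expand = solve 8 (λ r s t u h i j k →
      normₛ (r :+ h :* con (+ 4)) (s :+ i :* con (+ 4)) (t :+ j :* con (+ 4)) (u :+ k :* con (+ 4)) :=
      normₛ r s t u :+ (h :* (r :+ h :* con (+ 2)) :+ i :* (s :+ i :* con (+ 2))
        :+ j :* (t :+ j :* con (+ 2)) :+ k :* (u :+ k :* con (+ 2))) :* con (+ 8)) refl

  -- Descent: by `norm-even` and cyclic rotation all four entries are even, and halving them divides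
  -- the norm by 4. The odd exponent guarantees the factor 8 whenever `n` is positive.
  norm-divisible : ∀ n a b c d → (+ 2) ^ suc (n ℕ.* 2) ∣ norm ⟨ a , b , c , d ⟩ → (+ 2) ^ n ∣ a
  norm-divisible zero    a b c d _  = 1∣ a
  norm-divisible (suc n) a b c d 2∣ = halve (norm-even a b c d 8∣)
      (norm-even b c d a (subst (+ 8 ∣_) (rotate a b c d) 8∣))
      (norm-even c d a b (subst (+ 8 ∣_) (trans (rotate a b c d) (rotate b c d a)) 8∣))
      (norm-even d a b c (subst (+ 8 ∣_) (sym (rotate d a b c)) 8∣))
    where
    E : ℤ
    E = (+ 2) ^ suc (n ℕ.* 2)
    8∣ : + 8 ∣ norm ⟨ a , b , c , d ⟩
    8∣ = ∣-trans (divides ((+ 2) ^ (n ℕ.* 2))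
      (solve 1 (λ e → con (+ 2) :* (con (+ 2) :* (con (+ 2) :* e)) := e :* con (+ 8)) refl ((+ 2) ^ (n ℕ.* 2)))) 2∣
    rotate : ∀ a b c d → norm ⟨ a , b , c , d ⟩ ≡ norm ⟨ b , c , d , a ⟩
    rotate = solve 4 (λ a b c d → normₛ a b c d := normₛ b c d a) refl
    quarter : ∀ a b c d → norm ⟨ a * + 2 , b * + 2 , c * + 2 , d * + 2 ⟩ ≡ + 4 * norm ⟨ a , b , c , d ⟩
    quarter = solve 4 (λ a b c d →
      normₛ (a :* con (+ 2)) (b :* con (+ 2)) (c :* con (+ 2)) (d :* con (+ 2)) := con (+ 4) :* normₛ a b c d) refl
    four : + 2 * (+ 2 * E) ≡ + 4 * E
    four = solve 1 (λ e → con (+ 2) :* (con (+ 2) :* e) := con (+ 4) :* e) refl E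
    halve : + 2 ∣ a → + 2 ∣ b → + 2 ∣ c → + 2 ∣ d → + 2 * (+ 2) ^ n ∣ a
    halve (divides a′ refl) (divides b′ refl) (divides c′ refl) (divides d′ refl) =
      subst (_∣ a′ * + 2) (ℤₚ.*-comm ((+ 2) ^ n) (+ 2)) (*-monoˡ-∣ (+ 2) (norm-divisible n a′ b′ c′ d′
        (*-cancelˡ-∣ (+ 4) (subst₂ _∣_ four (quarter a′ b′ c′ d′) 2∣))))

  -- Euler's identity exhibits norm p * norm q as a sum of four squares, one of which is (dot p q)².
  dot-divisible : ∀ n p q → (+ 2) ^ suc n ∣ norm p → (+ 2) ^ n ∣ norm q → (+ 2) ^ n ∣ dot p q
  dot-divisible n p@(⟨ a , b , c , d ⟩) q@(⟨ a′ , b′ , c′ , d′ ⟩) 2∣p 2∣q =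
    norm-divisible n (dot p q) (minor a b c d a′ b′ c′ d′)
      (minor a c d b a′ c′ d′ b′) (minor a d b c a′ d′ b′ c′)
      (subst₂ _∣_ (pow n) (euler a b c d a′ b′ c′ d′)
        (∣-trans (*-monoˡ-∣ ((+ 2) ^ n) 2∣p) (*-monoʳ-∣ (norm p) 2∣q)))
    where
    pow : ∀ n → (+ 2) ^ suc n * (+ 2) ^ n ≡ (+ 2) ^ suc (n ℕ.* 2)
    pow zero    = refl
    pow (suc n) = trans (rearrange ((+ 2) ^ n)) (cong (λ e → + 2 * (+ 2 * e)) (pow n))
      where
      rearrange : ∀ e → + 2 * (+ 2 * e) * (+ 2 * e) ≡ + 2 * (+ 2 * (+ 2 * e * e))
      rearrange = solve 1 (λ e →
        con (+ 2) :* (con (+ 2) :* e) :* (con (+ 2) :* e) := con (+ 2) :* (con (+ 2) :* (con (+ 2) :* e :* e))) refl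
    -- In the quaternion product of q with the conjugate of p, `dot` is the real part, and `minor`
    -- gives the imaginary parts as b, c, d are permuted cyclically.
    minor : (a b c d a′ b′ c′ d′ : ℤ) → ℤ
    minor a b c d a′ b′ c′ d′ = a * b′ - b * a′ + (c * d′ - d * c′)
    minorₛ : ∀ {n} (a b c d a′ b′ c′ d′ : Polynomial n) → Polynomial n
    minorₛ a b c d a′ b′ c′ d′ = a :* b′ :- b :* a′ :+ (c :* d′ :- d :* c′)
    euler : ∀ a b c d a′ b′ c′ d′ → norm ⟨ a , b , c , d ⟩ * norm ⟨ a′ , b′ , c′ , d′ ⟩ ≡
      norm ⟨ dot ⟨ a , b , c , d ⟩ ⟨ a′ , b′ , c′ , d′ ⟩ , minor a b c d a′ b′ c′ d′ ,
             minor a c d b a′ c′ d′ b′ , minor a d b c a′ d′ b′ c′ ⟩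
    euler = solve 8 (λ a b c d a′ b′ c′ d′ → normₛ a b c d :* normₛ a′ b′ c′ d′ :=
      normₛ (a :* a′ :+ b :* b′ :+ c :* c′ :+ d :* d′) (minorₛ a b c d a′ b′ c′ d′)
            (minorₛ a c d b a′ c′ d′ b′) (minorₛ a d b c a′ d′ b′ c′)) refl

  -- The coefficients of the power series ∥ Σ gᵢ xⁱ ∥², obtained by splitting off g₀.
  normSeries : (ℕ → ℤ⁴) → ℕ → ℤ
  normSeries g zero          = norm (g 0)
  normSeries g (suc zero)    = + 2 * dot (g 0) (g 1)
  normSeries g (suc (suc n)) = + 2 * dot (g 0) (g (suc (suc n))) + normSeries (g ∘ suc) n

  -- `dot-divisible` asks for one more factor 2 on one side. With equal exponents it is applied one
  -- level lower, and the factor 2 in front of `dot` makes up for the loss.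
  double-dot-divisible : ∀ n p q → (+ 2) ^ n ∣ norm p → (+ 2) ^ n ∣ norm q → (+ 2) ^ n ∣ + 2 * dot p q
  double-dot-divisible zero    p q _   _   = 1∣ (+ 2 * dot p q)
  double-dot-divisible (suc n) p q 2∣p 2∣q =
    *-monoʳ-∣ (+ 2) (dot-divisible n p q 2∣p (∣-trans (divides (+ 2) refl) 2∣q))

  -- An odd index is never of the form i + i, so only cross terms 2⟨gᵢ, gⱼ⟩ occur.
  normSeries-odd : ∀ n g → (∀ i → (+ 2) ^ n ∣ norm (g i)) → ∀ j → (+ 2) ^ n ∣ normSeries g (suc (j ℕ.* 2))
  normSeries-odd n g 2∣ zero    = double-dot-divisible n (g 0) (g 1) (2∣ 0) (2∣ 1)
  normSeries-odd n g 2∣ (suc j) = ∣m∣n⇒∣m+n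
    (double-dot-divisible n (g 0) (g (suc (suc j ℕ.* 2))) (2∣ 0) (2∣ (suc (suc j ℕ.* 2))))
    (normSeries-odd n (g ∘ suc) (2∣ ∘ suc) j)

  -- The coefficient of x²ʲ is ∥gⱼ∥² plus cross terms 2⟨gᵢ, g₂ⱼ₋ᵢ⟩ with i < j. There gᵢ has exponent
  -- n + 1 and its partner has n, which is the uneven hypothesis of `dot-divisible`. Peeling off g₀
  -- moves the centre j down by one.
  normSeries-even : ∀ n g → (∀ i → (+ 2) ^ n ∣ norm (g i)) →
                    ∀ j → (∀ {i} → i ℕ.< j → (+ 2) ^ suc n ∣ norm (g i)) →
                    (+ 2) ^ suc n ∣ normSeries g (j ℕ.* 2) → (+ 2) ^ suc n ∣ norm (g j)
  normSeries-even n g 2∣ zero    2∣< 2∣S = 2∣S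
  normSeries-even n g 2∣ (suc j) 2∣< 2∣S = normSeries-even n (g ∘ suc) (2∣ ∘ suc) j (2∣< ∘ ℕ.s<s)
    (∣m+n∣m⇒∣n 2∣S (*-monoʳ-∣ (+ 2) (dot-divisible n (g 0) (g (suc j ℕ.* 2)) (2∣< ℕ.z<s) (2∣ (suc j ℕ.* 2)))))

  2^-divisible⇒≡0 : ∀ y → (∀ n → (+ 2) ^ n ∣ y) → y ≡ + 0
  2^-divisible⇒≡0 y 2∣y = ℤₚ.∣i∣≡0⇒i≡0 (helper ∣ y ∣ (λ n → subst (ℕ∣._∣ ∣ y ∣) (abs-2^ n) (∣⇒∣ᵤ (2∣y n))))
    where
    abs-2^ : ∀ n → ∣ (+ 2) ^ n ∣ ≡ 2 ℕ.^ n
    abs-2^ zero    = refl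
    abs-2^ (suc n) = trans (ℤₚ.abs-* (+ 2) ((+ 2) ^ n)) (cong (2 ℕ.*_) (abs-2^ n))
    n<2^n : ∀ n → n ℕ.< 2 ℕ.^ n
    n<2^n zero    = ℕ.z<s
    n<2^n (suc n) = ℕₚ.+-mono-≤ (ℕₚ.≤-trans (ℕ.s≤s ℕ.z≤n) (n<2^n n)) (ℕₚ.≤-trans (n<2^n n) (ℕₚ.m≤m+n _ 0))
    helper : ∀ m → (∀ n → 2 ℕ.^ n ℕ∣.∣ m) → m ≡ 0
    helper zero    _  = refl
    helper (suc m) 2∣ = contradiction (ℕ∣.∣⇒≤ (2∣ (suc m))) (ℕₚ.<⇒≱ (n<2^n (suc m)))

  -- A self-improving bound: 2ⁿ ∣ y gives 2ⁿ⁺¹ ∣ 4y, so 2ⁿ⁺¹ divides all even coefficients, hence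
  -- all norms, hence the odd coefficient y itself.
  normSeries-anisotropic : ∀ g k → (∀ j → + 4 * normSeries g (suc (k ℕ.* 2)) ∣ normSeries g (j ℕ.* 2)) →
                           normSeries g (suc (k ℕ.* 2)) ≡ + 0
  normSeries-anisotropic g k even = 2^-divisible⇒≡0 y 2∣y
    where
    y : ℤ
    y = normSeries g (suc (k ℕ.* 2))
    -- Induction on the exponent and, inside it, well-founded induction on j: `normSeries-even`
    -- needs exponent n at all indices and n + 1 at the smaller ones.
    norms : ∀ n → (+ 2) ^ n ∣ + 4 * y → ∀ j → (+ 2) ^ n ∣ norm (g j)
    norms zero    _  j = 1∣ (norm (g j))
    norms (suc n) 2∣ = <-rec _ λ j rec →
      normSeries-even n g (norms n (∣-trans (divides (+ 2) refl) 2∣)) j rec (∣-trans 2∣ (even j))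
    2∣y : ∀ n → (+ 2) ^ n ∣ y
    2∣y zero    = 1∣ y
    2∣y (suc n) = normSeries-odd (suc n) g (norms (suc n)
      (∣-trans (*-monoʳ-∣ (+ 2) (2∣y n)) (divides (+ 2) (four y)))) k
      where
      four : ∀ y → + 4 * y ≡ + 2 * (+ 2 * y)
      four = solve 1 (λ y → con (+ 4) :* y := con (+ 2) :* (con (+ 2) :* y)) refl

-- Coefficients of rational polynomials

module RationalPolynomials where

  open ℚ using (ℚ; 0ℚ; 1ℚ; ½; _+_; _*_; _-_; -_; _/_; _≤_)

  coeff-+ : ∀ p q i → coeff (p +ₚ q) i ≡ coeff p i + coeff q i
  coeff-+ []      q       i       = sym (ℚₚ.+-identityˡ (coeff q i))
  coeff-+ (a ∷ p) []      i       = sym (ℚₚ.+-identityʳ (coeff (a ∷ p) i))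
  coeff-+ (a ∷ p) (b ∷ q) zero    = refl
  coeff-+ (a ∷ p) (b ∷ q) (suc i) = coeff-+ p q i

  coeff-map-* : ∀ a p i → coeff (map (a *_) p) i ≡ a * coeff p i
  coeff-map-* a []      i       = sym (ℚₚ.*-zeroʳ a)
  coeff-map-* a (b ∷ p) zero    = refl
  coeff-map-* a (b ∷ p) (suc i) = coeff-map-* a p i

  coeff-map-neg : ∀ p i → coeff (map -_ p) i ≡ - coeff p i
  coeff-map-neg []      i       = refl
  coeff-map-neg (b ∷ p) zero    = refl
  coeff-map-neg (b ∷ p) (suc i) = coeff-map-neg p i

  coeff-∷-*-zero : ∀ a p q → coeff ((a ∷ p) *ₚ q) 0 ≡ a * coeff q 0
  coeff-∷-*-zero a p q = trans (coeff-+ (map (a *_) q) (0ℚ ∷ p *ₚ q) 0)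
    (trans (ℚₚ.+-identityʳ _) (coeff-map-* a q 0))

  coeff-∷-*-suc : ∀ a p q i → coeff ((a ∷ p) *ₚ q) (suc i) ≡ a * coeff q (suc i) + coeff (p *ₚ q) i
  coeff-∷-*-suc a p q i = trans (coeff-+ (map (a *_) q) (0ℚ ∷ p *ₚ q) (suc i))
    (cong (_+ coeff (p *ₚ q) i) (coeff-map-* a q (suc i)))

  -- The Kronecker delta. Coefficients are written as combinations of `int (δ n i)`, so that
  -- polynomial identities become ring identities with the deltas as opaque variables. Integer
  -- values let the four-squares argument over `ℤ` use the same deltas.
  δ : ℕ → ℕ → ℤ
  δ zero    zero    = + 1
  δ zero    (suc i) = + 0
  δ (suc n) zero    = + 0
  δ (suc n) (suc i) = δ n i

  δ-diag : ∀ n → δ n n ≡ + 1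
  δ-diag zero    = refl
  δ-diag (suc n) = δ-diag n

  δ-even-odd : ∀ i j → δ (i ℕ.* 2) (suc (j ℕ.* 2)) ≡ + 0
  δ-even-odd zero    j       = refl
  δ-even-odd (suc i) zero    = refl
  δ-even-odd (suc i) (suc j) = δ-even-odd i j

  δ-odd-even : ∀ i j → δ (suc (i ℕ.* 2)) (j ℕ.* 2) ≡ + 0
  δ-odd-even i       zero    = refl
  δ-odd-even zero    (suc j) = refl
  δ-odd-even (suc i) (suc j) = δ-odd-even i j

  coeff-monomial : ∀ a n i → coeff (monomial a n) i ≡ a * int (δ n i)
  coeff-monomial a zero    zero    = sym (ℚₚ.*-identityʳ a)
  coeff-monomial a zero    (suc i) = sym (ℚₚ.*-zeroʳ a)
  coeff-monomial a (suc n) zero    = sym (ℚₚ.*-zeroʳ a)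
  coeff-monomial a (suc n) (suc i) = coeff-monomial a n i

  coeff-monomial-* : ∀ b m p {c d s t} → (∀ i → coeff p i ≡ c * int (δ s i) + d * int (δ t i)) →
    ∀ i → coeff (monomial b m *ₚ p) i ≡ b * c * int (δ (m ℕ.+ s) i) + b * d * int (δ (m ℕ.+ t) i)
  coeff-monomial-* b zero p {c} {d} {s} {t} eq i = begin
    coeff (map (b *_) p +ₚ (0ℚ ∷ [])) i                 ≡⟨ coeff-+ (map (b *_) p) (0ℚ ∷ []) i ⟩
    coeff (map (b *_) p) i + coeff (0ℚ ∷ []) i
      ≡⟨ cong₂ _+_ (trans (coeff-map-* b p i) (cong (b *_) (eq i))) (coeff-0 i) ⟩
    b * (c * int (δ s i) + d * int (δ t i)) + 0ℚ
      ≡⟨ solve 5 (λ b c d x y → b :* (c :* x :+ d :* y) :+ con 0ℚ := b :* c :* x :+ b :* d :* y) refl b c d (int (δ s i)) (int (δ t i)) ⟩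
    b * c * int (δ s i) + b * d * int (δ t i)           ∎
    where
    open ≡-Reasoning
    open ℚ-Solver
    coeff-0 : ∀ i → coeff (0ℚ ∷ []) i ≡ 0ℚ
    coeff-0 zero    = refl
    coeff-0 (suc i) = refl
  coeff-monomial-* b (suc m) p {c} {d} eq zero = trans (coeff-∷-*-zero 0ℚ (monomial b m) p)
    (solve 4 (λ x b c d → con 0ℚ :* x := b :* c :* con 0ℚ :+ b :* d :* con 0ℚ) refl (coeff p 0) b c d)
    where open ℚ-Solver
  coeff-monomial-* b (suc m) p eq (suc i) = trans (coeff-∷-*-suc 0ℚ (monomial b m) p i)
    (trans (cong (_+ coeff (monomial b m *ₚ p) i) (ℚₚ.*-zeroˡ (coeff p (suc i))))
      (trans (ℚₚ.+-identityˡ _) (coeff-monomial-* b m p eq i)))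

  -- The exponent is `suc n`; with `n = k * 2` this is a + b xᵐ for m = 2k + 1.
  binomial : ℚ → ℚ → ℕ → ℚ[x].Poly
  binomial a b n = a ∷ monomial b n

  coeff-binomial : ∀ a b n i → coeff (binomial a b n) i ≡ a * int (δ 0 i) + b * int (δ (suc n) i)
  coeff-binomial a b n zero    = solve 2 (λ a b → a := a :* con 1ℚ :+ b :* con 0ℚ) refl a b
    where open ℚ-Solver
  coeff-binomial a b n (suc i) = trans (coeff-monomial b n i)
    (solve 2 (λ a y → y := a :* con 0ℚ :+ y) refl a (b * int (δ n i)))
    where open ℚ-Solver

  coeff-binomial-* : ∀ a b a′ b′ n i → coeff (binomial a b n *ₚ binomial a′ b′ n) i ≡
    b * b′ * int (δ (suc n ℕ.* 2) i) + (a * b′ + b * a′) * int (δ (suc n) i) + a * a′ * int (δ 0 i)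
  coeff-binomial-* a b a′ b′ n zero = trans (coeff-∷-*-zero a (monomial b n) (binomial a′ b′ n))
    (solve 4 (λ a b a′ b′ → a :* a′ := b :* b′ :* con 0ℚ :+ (a :* b′ :+ b :* a′) :* con 0ℚ :+ a :* a′ :* con 1ℚ)
      refl a b a′ b′)
    where open ℚ-Solver
  coeff-binomial-* a b a′ b′ n (suc i) = begin
    coeff (binomial a b n *ₚ binomial a′ b′ n) (suc i)
      ≡⟨ coeff-∷-*-suc a (monomial b n) (binomial a′ b′ n) i ⟩
    a * coeff (monomial b′ n) i + coeff (monomial b n *ₚ binomial a′ b′ n) i
      ≡⟨ cong₂ _+_ (cong (a *_) (coeff-monomial b′ n i))
           (coeff-monomial-* b n (binomial a′ b′ n) (coeff-binomial a′ b′ n) i) ⟩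
    a * (b′ * int (δ n i)) + (b * a′ * int (δ (n ℕ.+ 0) i) + b * b′ * int (δ (n ℕ.+ suc n) i))
      ≡⟨ cong₂ (λ s t → a * (b′ * int (δ n i)) + (b * a′ * int (δ s i) + b * b′ * int (δ t i)))
           (ℕₚ.+-identityʳ n) (exponent n) ⟩
    a * (b′ * int (δ n i)) + (b * a′ * int (δ n i) + b * b′ * int (δ (suc (n ℕ.* 2)) i))
      ≡⟨ solve 6 (λ a b a′ b′ x y → a :* (b′ :* x) :+ (b :* a′ :* x :+ b :* b′ :* y)
           := b :* b′ :* y :+ (a :* b′ :+ b :* a′) :* x :+ a :* a′ :* con 0ℚ)
           refl a b a′ b′ (int (δ n i)) (int (δ (suc (n ℕ.* 2)) i)) ⟩
    b * b′ * int (δ (suc (n ℕ.* 2)) i) + (a * b′ + b * a′) * int (δ n i) + a * a′ * 0ℚ ∎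
    where
    open ≡-Reasoning
    open ℚ-Solver
    exponent : ∀ n → n ℕ.+ suc n ≡ suc (n ℕ.* 2)
    exponent n = trans (ℕₚ.+-suc n n) (cong suc (trans (cong (n ℕ.+_) (sym (ℕₚ.+-identityʳ n))) (ℕₚ.*-comm 2 n)))

  /-* : ∀ i n .{{_ : NonZero n}} → i / n * int (+ n) ≡ int i
  /-* i n@(suc n-1) = ℚₚ.toℚᵘ-injective (begin
    ℚ.toℚᵘ (i / n * int (+ n))               ≈⟨ ℚₚ.toℚᵘ-homo-* (i / n) (int (+ n)) ⟩
    ℚ.toℚᵘ (i / n) ℚᵘ.* ℚ.toℚᵘ (int (+ n))
      ≈⟨ ℚᵘₚ.*-cong (ℚₚ.toℚᵘ-fromℚᵘ (ℚᵘ.mkℚᵘ i n-1)) (ℚₚ.toℚᵘ-fromℚᵘ (ℚᵘ.mkℚᵘ (+ n) 0)) ⟩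
    ℚᵘ.mkℚᵘ i n-1 ℚᵘ.* ℚᵘ.mkℚᵘ (+ n) 0
      ≈⟨ ℚᵘ.*≡* (trans (ℤₚ.*-identityʳ (i ℤ.* + n)) (cong (λ k → i ℤ.* + suc k) (sym (ℕₚ.*-identityʳ n-1)))) ⟩
    ℚᵘ.mkℚᵘ i 0                              ≈⟨ ℚₚ.toℚᵘ-fromℚᵘ (ℚᵘ.mkℚᵘ i 0) ⟨
    ℚ.toℚᵘ (int i)                           ∎)
    where open ℚᵘₚ.≃-Reasoning

  int-injective : ∀ {i j} → int i ≡ int j → i ≡ j
  int-injective {i} {j} eq = trans (sym (ℤₚ.*-identityʳ i)) (trans (ℚᵘₚ.drop-*≡* (begin
    ℚᵘ.mkℚᵘ i 0        ≈⟨ ℚₚ.toℚᵘ-fromℚᵘ (ℚᵘ.mkℚᵘ i 0) ⟨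
    ℚ.toℚᵘ (int i)     ≡⟨ cong ℚ.toℚᵘ eq ⟩
    ℚ.toℚᵘ (int j)     ≈⟨ ℚₚ.toℚᵘ-fromℚᵘ (ℚᵘ.mkℚᵘ j 0) ⟩
    ℚᵘ.mkℚᵘ j 0        ∎)) (ℤₚ.*-identityʳ j))
    where open ℚᵘₚ.≃-Reasoning

  module _ (N : ℕ) .{{N≢0 : NonZero N}} where
    private
      instance N²≢0 = ℕₚ.m^n≢0 N 2

    invN² 4invN² : ℚ
    invN²  = + 1 / N ℕ.^ 2
    4invN² = + 4 / N ℕ.^ 2

    N² : ℚ
    N² = int (+ N) * int (+ N)

    int-N^2 : int (+ (N ℕ.^ 2)) ≡ N²
    int-N^2 = trans (cong int (trans (ℤₚ.pos-* N (N ℕ.* 1)) (cong (λ x → + N ℤ.* + x) (ℕₚ.*-identityʳ N)))) (int-* (+ N) (+ N))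

    invN²-* : invN² * N² ≡ 1ℚ
    invN²-* = trans (cong (invN² *_) (sym int-N^2)) (/-* (+ 1) (N ℕ.^ 2))

    4invN²-≡ : 4invN² ≡ int (+ 4) * invN²
    4invN²-≡ = begin
      4invN²                       ≡⟨ ℚₚ.*-identityʳ 4invN² ⟨
      4invN² * 1ℚ                  ≡⟨ cong (4invN² *_) invN²-* ⟨
      4invN² * (invN² * N²)        ≡⟨ solve 3 (λ a b c → a :* (b :* c) := a :* c :* b) refl 4invN² invN² N² ⟩
      4invN² * N² * invN²          ≡⟨ cong (_* invN²) (trans (cong (4invN² *_) (sym int-N^2)) (/-* (+ 4) (N ℕ.^ 2))) ⟩
      int (+ 4) * invN²            ∎
      where
      open ≡-Reasoning
      open ℚ-Solver

    coeff-f : ∀ k i → coeff f[ k , N ] i ≡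
      int (+ 4) * invN² * int (δ (suc (k ℕ.* 2) ℕ.* 2) i) + invN² * int (δ (suc (k ℕ.* 2)) i) + int (+ 4) * invN² * int (δ 0 i)
    coeff-f k i = begin
      coeff f[ k , N ] i
        ≡⟨ trans (coeff-+ (monomial 4invN² (2 ℕ.* m) +ₚ monomial invN² m) (monomial 4invN² 0) i)
             (cong (_+ _) (coeff-+ (monomial 4invN² (2 ℕ.* m)) (monomial invN² m) i)) ⟩
      coeff (monomial 4invN² (2 ℕ.* m)) i + coeff (monomial invN² m) i + coeff (monomial 4invN² 0) i
        ≡⟨ cong₂ _+_ (cong₂ _+_ (coeff-monomial 4invN² (2 ℕ.* m) i) (coeff-monomial invN² m i)) (coeff-monomial 4invN² 0 i) ⟩
      4invN² * int (δ (2 ℕ.* m) i) + invN² * int (δ m i) + 4invN² * int (δ 0 i)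
        ≡⟨ cong₂ (λ s t → 4invN² * int (δ s i) + invN² * int (δ t i) + 4invN² * int (δ 0 i))
             (trans (ℕₚ.*-comm 2 m) (cong (ℕ._* 2) m≡)) m≡ ⟩
      4invN² * int (δ (suc (k ℕ.* 2) ℕ.* 2) i) + invN² * int (δ (suc (k ℕ.* 2)) i) + 4invN² * int (δ 0 i)
        ≡⟨ cong (λ a → a * int (δ (suc (k ℕ.* 2) ℕ.* 2) i) + invN² * int (δ (suc (k ℕ.* 2)) i) + a * int (δ 0 i)) 4invN²-≡ ⟩
      int (+ 4) * invN² * int (δ (suc (k ℕ.* 2) ℕ.* 2) i) + invN² * int (δ (suc (k ℕ.* 2)) i) + int (+ 4) * invN² * int (δ 0 i) ∎
      where
      open ≡-Reasoning
      m = 2 ℕ.* k ℕ.+ 1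
      m≡ : m ≡ suc (k ℕ.* 2)
      m≡ = trans (ℕₚ.+-comm (2 ℕ.* k) 1) (cong suc (ℕₚ.*-comm 2 k))

-- f is not a sum of four squares

module SumsOfFourSquares where

  open IntegerQuadruples
  open RationalPolynomials
  open ℚ using (ℚ; 0ℚ; 1ℚ; ½; _+_; _*_; _-_; -_; _/_; _≤_)
  open import Data.Integer.Divisibility.Signed using (divides)
  open import Data.List.Relation.Unary.All as All using (All; []; _∷_)

  -- The coefficients of the power series (Σ aᵢ xⁱ)², in the shape of normSeries.
  squareSeries : (ℕ → ℚ) → ℕ → ℚ
  squareSeries a zero          = a 0 * a 0
  squareSeries a (suc zero)    = 2ℚ * (a 0 * a 1)
  squareSeries a (suc (suc n)) = 2ℚ * (a 0 * a (suc (suc n))) + squareSeries (a ∘ suc) n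

  squareSeries-0 : ∀ n → squareSeries (λ _ → 0ℚ) n ≡ 0ℚ
  squareSeries-0 zero          = refl
  squareSeries-0 (suc zero)    = refl
  squareSeries-0 (suc (suc n)) = trans (ℚₚ.+-identityˡ _) (squareSeries-0 n)

  -- `*ₚ` recurses on its left factor; this is the recursion on the right one. Splitting the
  -- constant term off a square takes both.
  coeff-*-∷-suc : ∀ p a q i → coeff (p *ₚ (a ∷ q)) (suc i) ≡ a * coeff p (suc i) + coeff (p *ₚ q) i
  coeff-*-∷-suc []      a q i       = sym (trans (ℚₚ.+-identityʳ (a * 0ℚ)) (ℚₚ.*-zeroʳ a))
  coeff-*-∷-suc (b ∷ p) a q zero    = begin
    coeff ((b ∷ p) *ₚ (a ∷ q)) 1                ≡⟨ coeff-∷-*-suc b p (a ∷ q) 0 ⟩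
    b * coeff q 0 + coeff (p *ₚ (a ∷ q)) 0      ≡⟨ cong (λ y → b * coeff q 0 + y) (coeff-*-zero p) ⟩
    b * coeff q 0 + coeff p 0 * a
      ≡⟨ solve 4 (λ b c d a → b :* c :+ d :* a := a :* d :+ b :* c) refl b (coeff q 0) (coeff p 0) a ⟩
    a * coeff p 0 + b * coeff q 0               ≡⟨ cong (λ y → a * coeff p 0 + y) (coeff-∷-*-zero b p q) ⟨
    a * coeff p 0 + coeff ((b ∷ p) *ₚ q) 0      ∎
    where
    open ≡-Reasoning
    open ℚ-Solver
    coeff-*-zero : ∀ p → coeff (p *ₚ (a ∷ q)) 0 ≡ coeff p 0 * a
    coeff-*-zero []      = sym (ℚₚ.*-zeroˡ a)
    coeff-*-zero (c ∷ p) = ℚₚ.+-identityʳ (c * a)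
  coeff-*-∷-suc (b ∷ p) a q (suc i) = begin
    coeff ((b ∷ p) *ₚ (a ∷ q)) (suc (suc i))
      ≡⟨ coeff-∷-*-suc b p (a ∷ q) (suc i) ⟩
    b * coeff q (suc i) + coeff (p *ₚ (a ∷ q)) (suc i)
      ≡⟨ cong (λ y → b * coeff q (suc i) + y) (coeff-*-∷-suc p a q i) ⟩
    b * coeff q (suc i) + (a * coeff p (suc i) + coeff (p *ₚ q) i)
      ≡⟨ solve 3 (λ x y z → x :+ (y :+ z) := y :+ (x :+ z)) refl (b * coeff q (suc i)) (a * coeff p (suc i)) (coeff (p *ₚ q) i) ⟩
    a * coeff p (suc i) + (b * coeff q (suc i) + coeff (p *ₚ q) i)
      ≡⟨ cong (λ y → a * coeff p (suc i) + y) (coeff-∷-*-suc b p q i) ⟨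
    a * coeff p (suc i) + coeff ((b ∷ p) *ₚ q) (suc i) ∎
    where
    open ≡-Reasoning
    open ℚ-Solver

  coeff-square : ∀ p n → coeff (p *ₚ p) n ≡ squareSeries (coeff p) n
  coeff-square []      n             = sym (squareSeries-0 n)
  coeff-square (a ∷ p) zero          = coeff-∷-*-zero a p (a ∷ p)
  coeff-square (a ∷ p) (suc zero)    = trans (coeff-*-∷-suc (a ∷ p) a p 0)
    (trans (cong (λ y → a * coeff p 0 + y) (coeff-∷-*-zero a p p))
      (solve 2 (λ a b → a :* b :+ a :* b := con 2ℚ :* (a :* b)) refl a (coeff p 0)))
    where open ℚ-Solver
  coeff-square (a ∷ p) (suc (suc n)) = begin
    coeff ((a ∷ p) *ₚ (a ∷ p)) (suc (suc n))
      ≡⟨ coeff-*-∷-suc (a ∷ p) a p (suc n) ⟩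
    a * x + coeff ((a ∷ p) *ₚ p) (suc n)
      ≡⟨ cong (λ y → a * x + y) (coeff-∷-*-suc a p p n) ⟩
    a * x + (a * x + coeff (p *ₚ p) n)
      ≡⟨ cong (λ y → a * x + (a * x + y)) (coeff-square p n) ⟩
    a * x + (a * x + squareSeries (coeff p) n)
      ≡⟨ solve 3 (λ a x y → a :* x :+ (a :* x :+ y) := con 2ℚ :* (a :* x) :+ y) refl a x (squareSeries (coeff p) n) ⟩
    2ℚ * (a * x) + squareSeries (coeff p) n ∎
    where
    open ≡-Reasoning
    open ℚ-Solver
    x = coeff p (suc n)

  -- Stated for arbitrary sequences because the recursion of `normSeries` passes to shifted ones.
  int-normSeries : ∀ E (g₁ g₂ g₃ g₄ : ℕ → ℤ) (a b c d : ℕ → ℚ) →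
    (∀ i → int (g₁ i) ≡ E * a i) → (∀ i → int (g₂ i) ≡ E * b i) →
    (∀ i → int (g₃ i) ≡ E * c i) → (∀ i → int (g₄ i) ≡ E * d i) →
    ∀ n → int (normSeries (λ i → ⟨ g₁ i , g₂ i , g₃ i , g₄ i ⟩) n) ≡
          E * E * (squareSeries a n + squareSeries b n + squareSeries c n + squareSeries d n)
  int-normSeries E g₁ g₂ g₃ g₄ a b c d e₁ e₂ e₃ e₄ = series
    where
    open ≡-Reasoning
    open ℚ-Solver
    g : ℕ → ℤ⁴
    g i = ⟨ g₁ i , g₂ i , g₃ i , g₄ i ⟩
    product : ∀ (h : ℕ → ℤ) (e : ℕ → ℚ) → (∀ i → int (h i) ≡ E * e i) →
              ∀ i j → int (h i ℤ.* h j) ≡ E * e i * (E * e j)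
    product h e eq i j = trans (int-* (h i) (h j)) (cong₂ _*_ (eq i) (eq j))
    int-dot : ∀ i j → int (dot (g i) (g j)) ≡ E * E * (a i * a j + b i * b j + c i * c j + d i * d j)
    int-dot i j = begin
      int (g₁ i ℤ.* g₁ j ℤ.+ g₂ i ℤ.* g₂ j ℤ.+ g₃ i ℤ.* g₃ j ℤ.+ g₄ i ℤ.* g₄ j)
        ≡⟨ trans (int-+ (g₁ i ℤ.* g₁ j ℤ.+ g₂ i ℤ.* g₂ j ℤ.+ g₃ i ℤ.* g₃ j) (g₄ i ℤ.* g₄ j))
             (cong (_+ _) (trans (int-+ (g₁ i ℤ.* g₁ j ℤ.+ g₂ i ℤ.* g₂ j) (g₃ i ℤ.* g₃ j))
               (cong (_+ _) (int-+ (g₁ i ℤ.* g₁ j) (g₂ i ℤ.* g₂ j))))) ⟩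
      int (g₁ i ℤ.* g₁ j) + int (g₂ i ℤ.* g₂ j) + int (g₃ i ℤ.* g₃ j) + int (g₄ i ℤ.* g₄ j)
        ≡⟨ cong₂ _+_ (cong₂ _+_ (cong₂ _+_ (product g₁ a e₁ i j) (product g₂ b e₂ i j)) (product g₃ c e₃ i j)) (product g₄ d e₄ i j) ⟩
      E * a i * (E * a j) + E * b i * (E * b j) + E * c i * (E * c j) + E * d i * (E * d j)
        ≡⟨ solve 9 (λ E a b c d a′ b′ c′ d′ →
             E :* a :* (E :* a′) :+ E :* b :* (E :* b′) :+ E :* c :* (E :* c′) :+ E :* d :* (E :* d′)
             := E :* E :* (a :* a′ :+ b :* b′ :+ c :* c′ :+ d :* d′))
             refl E (a i) (b i) (c i) (d i) (a j) (b j) (c j) (d j) ⟩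
      E * E * (a i * a j + b i * b j + c i * c j + d i * d j) ∎
    int-2dot : ∀ i j → int (+ 2 ℤ.* dot (g i) (g j)) ≡
      E * E * (2ℚ * (a i * a j) + 2ℚ * (b i * b j) + 2ℚ * (c i * c j) + 2ℚ * (d i * d j))
    int-2dot i j = trans (int-* (+ 2) (dot (g i) (g j))) (trans (cong (2ℚ *_) (int-dot i j))
      (solve 5 (λ e x y z w → con 2ℚ :* (e :* (x :+ y :+ z :+ w)) :=
          e :* (con 2ℚ :* x :+ con 2ℚ :* y :+ con 2ℚ :* z :+ con 2ℚ :* w))
        refl (E * E) (a i * a j) (b i * b j) (c i * c j) (d i * d j)))
    series : ∀ n → int (normSeries g n) ≡
      E * E * (squareSeries a n + squareSeries b n + squareSeries c n + squareSeries d n)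
    series zero          = int-dot 0 0
    series (suc zero)    = int-2dot 0 1
    series (suc (suc n)) = begin
      int (+ 2 ℤ.* dot (g 0) (g (suc (suc n))) ℤ.+ normSeries (g ∘ suc) n)
        ≡⟨ int-+ (+ 2 ℤ.* dot (g 0) (g (suc (suc n)))) (normSeries (g ∘ suc) n) ⟩
      int (+ 2 ℤ.* dot (g 0) (g (suc (suc n)))) + int (normSeries (g ∘ suc) n)
        ≡⟨ cong₂ _+_ (int-2dot 0 (suc (suc n)))
             (int-normSeries E (g₁ ∘ suc) (g₂ ∘ suc) (g₃ ∘ suc) (g₄ ∘ suc) (a ∘ suc) (b ∘ suc) (c ∘ suc) (d ∘ suc)
               (e₁ ∘ suc) (e₂ ∘ suc) (e₃ ∘ suc) (e₄ ∘ suc) n) ⟩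
      _ ≡⟨ solve 9 (λ e x y z w x′ y′ z′ w′ → e :* (x :+ y :+ z :+ w) :+ e :* (x′ :+ y′ :+ z′ :+ w′) :=
             e :* ((x :+ x′) :+ (y :+ y′) :+ (z :+ z′) :+ (w :+ w′))) refl (E * E)
             (2ℚ * (a 0 * a (suc (suc n)))) (2ℚ * (b 0 * b (suc (suc n))))
             (2ℚ * (c 0 * c (suc (suc n)))) (2ℚ * (d 0 * d (suc (suc n))))
             (squareSeries (a ∘ suc) n) (squareSeries (b ∘ suc) n) (squareSeries (c ∘ suc) n) (squareSeries (d ∘ suc) n) ⟩
      _ ∎

  Integral : ℚ → Set
  Integral q = ∃[ z ] int z ≡ q

  clearDenominators : ∀ p → ∃[ D-1 ] All (λ a → Integral (int (+ suc D-1) * a)) p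
  clearDenominators []      = 0 , []
  clearDenominators (a ∷ p) =
    let (D-1 , integral) = clearDenominators p
        D = + suc D-1
    -- The successor of this number is, by computation, the denominator of `a` times `D`.
    in D-1 ℕ.+ ℚ.denominator-1 a ℕ.* suc D-1 , (ℚ.↥ a ℤ.* D , trans (int-* (ℚ.↥ a) D) (begin
               int (ℚ.↥ a) * int D          ≡⟨ cong (_* int D) (*-denominator a) ⟨
               a * int (ℚ.↧ a) * int D
                 ≡⟨ solve 3 (λ a b c → a :* b :* c := b :* c :* a) refl a (int (ℚ.↧ a)) (int D) ⟩
               int (ℚ.↧ a) * int D * a      ≡⟨ cong (_* a) (int-* (ℚ.↧ a) D) ⟨
               int (ℚ.↧ a ℤ.* D) * a        ∎))
           ∷ All.map (λ {b} (z , eq) → ℚ.↧ a ℤ.* z , (begin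
               int (ℚ.↧ a ℤ.* z)            ≡⟨ int-* (ℚ.↧ a) z ⟩
               int (ℚ.↧ a) * int z          ≡⟨ cong (int (ℚ.↧ a) *_) eq ⟩
               int (ℚ.↧ a) * (int D * b)    ≡⟨ ℚₚ.*-assoc (int (ℚ.↧ a)) (int D) b ⟨
               int (ℚ.↧ a) * int D * b      ≡⟨ cong (_* b) (int-* (ℚ.↧ a) D) ⟨
               int (ℚ.↧ a ℤ.* D) * b        ∎)) integral
    where
    open ≡-Reasoning
    open ℚ-Solver

  integralCoeff : ∀ E p → All (λ a → Integral (E * a)) p → ∀ i → Integral (E * coeff p i)
  integralCoeff E []      []       i       = + 0 , sym (ℚₚ.*-zeroʳ E)
  integralCoeff E (a ∷ p) (h ∷ _)  zero    = h
  integralCoeff E (a ∷ p) (_ ∷ hs) (suc i) = integralCoeff E p hs i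

  ¬SumOfFourSquares-f : ∀ k N .{{_ : NonZero N}} → ¬ SumOfFourSquares f[ k , N ]
  ¬SumOfFourSquares-f k N (p₁ , p₂ , p₃ , p₄ , f≈) =
    case D²≡0 of λ ()
    where
    open ≡-Reasoning
    -- Concatenation yields one common denominator for all four polynomials.
    cleared = clearDenominators (p₁ ++ p₂ ++ p₃ ++ p₄)
    D : ℤ
    D = + suc (proj₁ cleared)
    -- The factor N absorbs the 1/N² in f, so that E² f has the integer coefficients D² `φ i`.
    E : ℚ
    E = int (+ N) * int D
    m : ℕ
    m = suc (k ℕ.* 2)
    scale : ∀ {a} → Integral (int D * a) → Integral (E * a)
    scale {a} (z , eq) = + N ℤ.* z , trans (int-* (+ N) z) (trans (cong (int (+ N) *_) eq) (sym (ℚₚ.*-assoc (int (+ N)) (int D) a)))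
    split = All.map (λ {a} → scale {a}) (proj₂ cleared)
    a₁ = ++⁻ p₁ split
    a₂ = ++⁻ p₂ (proj₂ a₁)
    a₃ = ++⁻ p₃ (proj₂ a₂)
    c₁ = integralCoeff E p₁ (proj₁ a₁)
    c₂ = integralCoeff E p₂ (proj₁ a₂)
    c₃ = integralCoeff E p₃ (proj₁ a₃)
    c₄ = integralCoeff E p₄ (proj₂ a₃)
    g : ℕ → ℤ⁴
    g i = ⟨ proj₁ (c₁ i) , proj₁ (c₂ i) , proj₁ (c₃ i) , proj₁ (c₄ i) ⟩
    φ : ℕ → ℤ
    φ i = + 4 ℤ.* δ (m ℕ.* 2) i ℤ.+ δ m i ℤ.+ + 4 ℤ.* δ 0 i
    coeff-sum : ∀ i → coeff f[ k , N ] i ≡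
      squareSeries (coeff p₁) i + squareSeries (coeff p₂) i + squareSeries (coeff p₃) i + squareSeries (coeff p₄) i
    coeff-sum i = trans (f≈ i)
      (trans (coeff-+ (p₁ *ₚ p₁ +ₚ p₂ *ₚ p₂ +ₚ p₃ *ₚ p₃) (p₄ *ₚ p₄) i)
        (cong₂ _+_ (trans (coeff-+ (p₁ *ₚ p₁ +ₚ p₂ *ₚ p₂) (p₃ *ₚ p₃) i)
          (cong₂ _+_ (trans (coeff-+ (p₁ *ₚ p₁) (p₂ *ₚ p₂) i)
            (cong₂ _+_ (coeff-square p₁ i) (coeff-square p₂ i))) (coeff-square p₃ i))) (coeff-square p₄ i)))
    int-φ : ∀ i → int (φ i) ≡ int (+ 4) * int (δ (m ℕ.* 2) i) + int (δ m i) + int (+ 4) * int (δ 0 i)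
    int-φ i = trans (int-+ (+ 4 ℤ.* δ (m ℕ.* 2) i ℤ.+ δ m i) (+ 4 ℤ.* δ 0 i))
      (cong₂ _+_ (trans (int-+ (+ 4 ℤ.* δ (m ℕ.* 2) i) (δ m i)) (cong (_+ int (δ m i)) (int-* (+ 4) (δ (m ℕ.* 2) i)))) (int-* (+ 4) (δ 0 i)))
    normSeries-g : ∀ i → normSeries g i ≡ D ℤ.* D ℤ.* φ i
    normSeries-g i = int-injective (begin
      int (normSeries g i)
        ≡⟨ int-normSeries E (proj₁ ∘ c₁) (proj₁ ∘ c₂) (proj₁ ∘ c₃) (proj₁ ∘ c₄) (coeff p₁) (coeff p₂) (coeff p₃) (coeff p₄)
             (proj₂ ∘ c₁) (proj₂ ∘ c₂) (proj₂ ∘ c₃) (proj₂ ∘ c₄) i ⟩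
      _ ≡⟨ cong (λ y → E * E * y) (trans (sym (coeff-sum i)) (coeff-f N k i)) ⟩
      E * E * (int (+ 4) * invN² N * x + invN² N * y + int (+ 4) * invN² N * z)
        ≡⟨ solve 7 (λ r D c w x y z → r :* D :* (r :* D) :* (c :* w :* x :+ w :* y :+ c :* w :* z) :=
             w :* (r :* r) :* (D :* D :* (c :* x :+ y :+ c :* z))) refl (int (+ N)) (int D) (int (+ 4)) (invN² N) x y z ⟩
      invN² N * N² N * (int D * int D * (int (+ 4) * x + y + int (+ 4) * z))
        ≡⟨ trans (cong (_* q) (invN²-* N)) (ℚₚ.*-identityˡ q) ⟩
      int D * int D * (int (+ 4) * x + y + int (+ 4) * z)
        ≡⟨ cong₂ _*_ (int-* D D) (int-φ i) ⟨
      int (D ℤ.* D) * int (φ i)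
        ≡⟨ int-* (D ℤ.* D) (φ i) ⟨
      int (D ℤ.* D ℤ.* φ i) ∎)
      where
      open ℚ-Solver
      x = int (δ (m ℕ.* 2) i)
      y = int (δ m i)
      z = int (δ 0 i)
      q = int D * int D * (int (+ 4) * x + y + int (+ 4) * z)
    open ℤ-Solver
    odd-coeff : normSeries g m ≡ D ℤ.* D
    odd-coeff = trans (normSeries-g m)
      (trans (cong₂ (λ x y → D ℤ.* D ℤ.* (+ 4 ℤ.* x ℤ.+ y ℤ.+ + 0)) (δ-even-odd m k) (δ-diag m)) (ℤₚ.*-identityʳ (D ℤ.* D)))
    even-coeff : ∀ j → normSeries g (j ℕ.* 2) ≡ (δ (m ℕ.* 2) (j ℕ.* 2) ℤ.+ δ 0 (j ℕ.* 2)) ℤ.* (+ 4 ℤ.* normSeries g m)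
    even-coeff j = begin
      normSeries g (j ℕ.* 2)
        ≡⟨ normSeries-g (j ℕ.* 2) ⟩
      D ℤ.* D ℤ.* (+ 4 ℤ.* x ℤ.+ δ m (j ℕ.* 2) ℤ.+ + 4 ℤ.* z)
        ≡⟨ cong (λ y → D ℤ.* D ℤ.* (+ 4 ℤ.* x ℤ.+ y ℤ.+ + 4 ℤ.* z)) (δ-odd-even k j) ⟩
      D ℤ.* D ℤ.* (+ 4 ℤ.* x ℤ.+ + 0 ℤ.+ + 4 ℤ.* z)
        ≡⟨ solve 3 (λ e x z → e :* (con (+ 4) :* x :+ con (+ 0) :+ con (+ 4) :* z) := (x :+ z) :* (con (+ 4) :* e)) refl (D ℤ.* D) x z ⟩
      (x ℤ.+ z) ℤ.* (+ 4 ℤ.* (D ℤ.* D))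
        ≡⟨ cong (λ e → (x ℤ.+ z) ℤ.* (+ 4 ℤ.* e)) odd-coeff ⟨
      (x ℤ.+ z) ℤ.* (+ 4 ℤ.* normSeries g m) ∎
      where
      x = δ (m ℕ.* 2) (j ℕ.* 2)
      z = δ 0 (j ℕ.* 2)
    D²≡0 : D ℤ.* D ≡ + 0
    D²≡0 = trans (sym odd-coeff) (normSeries-anisotropic g k λ j → divides (δ (m ℕ.* 2) (j ℕ.* 2) ℤ.+ δ 0 (j ℕ.* 2)) (even-coeff j))

-- Null sequences and non-units of ℚ₂[x]

module TwoAdicPolynomials where

  open RationalPolynomials
  open ℚ using (ℚ; 0ℚ; 1ℚ; ½; _+_; _*_; _-_; -_; _/_; _≤_)
  open import Data.Integer.Divisibility.Signed
  open TwoAdic using (Carrier; seq; ι; _⊗_)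
  open IsBallSystem twoAdicBallSystem

  -- 2-adic convergence to 0. Equality in `ℚ₂` unfolds to `Null` of the termwise difference.
  Null : (ℕ → ℚ) → Set
  Null s = ∀ n → ∃[ M ] (∀ {i} → M ℕ.≤ i → TwoAdicBall n (s i))

  Null-resp : ∀ {s t} → (∀ i → s i ≡ t i) → Null s → Null t
  Null-resp eq null n = let (M , h) = null n in M , λ {i} M≤i → subst (TwoAdicBall n) (eq i) (h M≤i)

  Null-0 : Null (λ _ → 0ℚ)
  Null-0 n = 0 , λ _ → zero-∈ n

  Null-+ : ∀ {s t} → Null s → Null t → Null (λ i → s i + t i)
  Null-+ null-s null-t n =
    let (M₁ , h₁) = null-s (suc n)
        (M₂ , h₂) = null-t (suc n)
    in M₁ ℕ.⊔ M₂ , λ M≤i → add-∈ (h₁ (ℕₚ.m⊔n≤o⇒m≤o M₁ M₂ M≤i)) (h₂ (ℕₚ.m⊔n≤o⇒n≤o M₁ M₂ M≤i))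

  Null-neg : ∀ {s} → Null s → Null (λ i → - s i)
  Null-neg null n = let (M , h) = null n in M , λ M≤i → neg-∈ (h M≤i)

  Null-scale : ∀ q {s} → Null s → Null (λ i → q * s i)
  Null-scale q null n =
    let (m , scale) = scale-∈ q n
        (M , h)     = null m
    in M , λ M≤i → scale (h M≤i)

  -- The sequence of x is a constant X plus a remainder that stays in a ball: `Null-scale` treats X
  -- s, and `mul-∈` the remainder times s.
  Null-* : ∀ (x : Carrier) {s} → Null s → Null (λ i → seq x i * s i)
  Null-* x {s} null n =
    let (M₁ , h₁) = Carrier.cauchy x (suc n)
        X         = seq x M₁
        (M₂ , h₂) = Null-scale X null (suc n)
        (M₃ , h₃) = null (suc n)
    in M₁ ℕ.⊔ (M₂ ℕ.⊔ M₃) , λ {i} M≤i →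
      let M₂₃≤i = ℕₚ.m⊔n≤o⇒n≤o M₁ (M₂ ℕ.⊔ M₃) M≤i
      in subst (TwoAdicBall n)
        (solve 3 (λ x X s → X :* s :+ (x :- X) :* s := x :* s) refl (seq x i) X (s i))
        (add-∈ (h₂ (ℕₚ.m⊔n≤o⇒m≤o M₂ M₃ M₂₃≤i))
          (mul-∈ (h₁ (ℕₚ.m⊔n≤o⇒m≤o M₁ (M₂ ℕ.⊔ M₃) M≤i) ℕₚ.≤-refl) (h₃ (ℕₚ.m⊔n≤o⇒n≤o M₂ M₃ M₂₃≤i))))
    where open ℚ-Solver

  2∤odd : ∀ c → ¬ + 2 ∣ + 1 ℤ.+ + 2 ℤ.* c
  2∤odd c 2∣ = case ℕ∣.∣1⇒≡1 (∣⇒∣ᵤ (∣m+n∣n⇒∣m {m = + 1} 2∣ (∣m⇒∣m*n c ∣-refl))) of λ ()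

  -- If 1 lay in the ball of radius 1/2, an odd integer would be even.
  ¬Null-1 : ¬ Null (λ _ → 1ℚ)
  ¬Null-1 null with proj₂ (null 1) ℕₚ.≤-refl
  ... | mkBall a c eq = 2∤odd c (divides a (int-injective (begin
    int (+ 1 ℤ.+ + 2 ℤ.* c)          ≡⟨ ℚₚ.*-identityˡ _ ⟨
    1ℚ * int (+ 1 ℤ.+ + 2 ℤ.* c)     ≡⟨ eq ⟩
    2ℚ * int a                       ≡⟨ ℚₚ.*-comm 2ℚ (int a) ⟩
    int a * 2ℚ                       ≡⟨ int-* a (+ 2) ⟨
    int (a ℤ.* + 2)                  ∎)))
    where open ≡-Reasoning

  -- The i-th rational approximation of a polynomial over `ℚ₂`. Sums and products of Cauchy
  -- sequences are termwise, so it commutes with them exactly and not just up to a null sequence.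
  at : ℕ → ℚ₂[x].Poly → ℚ[x].Poly
  at i = map (λ x → seq x i)

  coeff-at : ∀ i p j → coeff (at i p) j ≡ seq (ℚ₂[x].coeff p j) i
  coeff-at i []      j       = refl
  coeff-at i (a ∷ p) zero    = refl
  coeff-at i (a ∷ p) (suc j) = coeff-at i p j

  at-+ : ∀ i p q → at i (p ℚ₂[x].+ₚ q) ≡ at i p +ₚ at i q
  at-+ i []      q       = refl
  at-+ i (a ∷ p) []      = refl
  at-+ i (a ∷ p) (b ∷ q) = cong (_ ∷_) (at-+ i p q)

  at-map-* : ∀ i a p → at i (map (a ⊗_) p) ≡ map (seq a i *_) (at i p)
  at-map-* i a []      = refl
  at-map-* i a (b ∷ p) = cong (_ ∷_) (at-map-* i a p)

  at-* : ∀ i p q → at i (p ℚ₂[x].*ₚ q) ≡ at i p *ₚ at i q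
  at-* i []      q = refl
  at-* i (a ∷ p) q = trans (at-+ i (map (a ⊗_) q) (ι 0ℚ ∷ p ℚ₂[x].*ₚ q))
    (cong₂ _+ₚ_ (at-map-* i a q) (cong (0ℚ ∷_) (at-* i p q)))

  at-ι : ∀ i p → at i (map ι p) ≡ p
  at-ι i []      = refl
  at-ι i (a ∷ p) = cong (a ∷_) (at-ι i p)

  binomial₂ : ℚ₂ → ℚ₂ → ℕ → ℚ₂[x].Poly
  binomial₂ a b n = a ∷ ℚ₂[x].monomial b n

  at-binomial : ∀ i a b n → at i (binomial₂ a b n) ≡ binomial (seq a i) (seq b i) n
  at-binomial i a b n = cong (seq a i ∷_) (at-monomial n)
    where
    at-monomial : ∀ n → at i (ℚ₂[x].monomial b n) ≡ monomial (seq b i) n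
    at-monomial zero    = refl
    at-monomial (suc n) = cong (0ℚ ∷_) (at-monomial n)

  NullPoly : ℚ₂[x].Poly → Set
  NullPoly p = ∀ j → Null (λ i → coeff (at i p) j)

  Null-coeff-* : ∀ p q → NullPoly p → NullPoly (p ℚ₂[x].*ₚ q)
  Null-coeff-* p q null j = Null-resp (λ i → cong (λ r → coeff r j) (sym (at-* i p q))) (helper p null j)
    where
    helper : ∀ p → NullPoly p → ∀ j → Null (λ i → coeff (at i p *ₚ at i q) j)
    helper []      null j       = Null-0
    helper (a ∷ p) null zero    = Null-resp
      (λ i → trans (cong (_* seq a i) (sym (coeff-at i q 0)))
        (trans (ℚₚ.*-comm (coeff (at i q) 0) (seq a i)) (sym (coeff-∷-*-zero (seq a i) (at i p) (at i q)))))
      (Null-* (ℚ₂[x].coeff q 0) (null 0))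
    helper (a ∷ p) null (suc j) = Null-resp
      (λ i → trans (cong (_+ coeff (at i p *ₚ at i q) j)
          (trans (cong (_* seq a i) (sym (coeff-at i q (suc j)))) (ℚₚ.*-comm (coeff (at i q) (suc j)) (seq a i))))
        (sym (coeff-∷-*-suc (seq a i) (at i p) (at i q) j)))
      (Null-+ (Null-* (ℚ₂[x].coeff q (suc j)) (null 0)) (helper p (null ∘ suc) j))

  coeff-monomial-above : ∀ b {n j} → n ℕ.< j → coeff (monomial b n) j ≡ 0ℚ
  coeff-monomial-above b {zero}  {suc j} _   = refl
  coeff-monomial-above b {suc n} {suc j} n<j = coeff-monomial-above b (ℕ.s<s⁻¹ n<j)

  coeff-monomial-diag : ∀ b n → coeff (monomial b n) n ≡ b
  coeff-monomial-diag b zero    = refl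
  coeff-monomial-diag b (suc n) = coeff-monomial-diag b n

  module _ (a b b⁻¹ : ℚ₂) (n : ℕ) (inverse : Null (λ i → seq b i * seq b⁻¹ i - 1ℚ)) where

    private
      g : ℕ → ℚ[x].Poly
      g i = binomial (seq a i) (seq b i) n

    -- The top coefficients of p * g determine p because the leading coefficient of g is invertible.
    Null-cancel : ∀ p → (∀ {j} → n ℕ.< j → Null (λ i → coeff (at i p *ₚ g i) j)) → NullPoly p
    Null-cancel []      null j = Null-0
    Null-cancel (c ∷ p) null   = λ where
        zero    → Null-c
        (suc j) → Null-p j
      where
      open ℚ-Solver
      Null-p : NullPoly p
      Null-p = Null-cancel p λ {j} n<j → Null-resp
        (λ i → trans (coeff-∷-*-suc (seq c i) (at i p) (g i) j)
          (trans (cong (λ x → seq c i * x + coeff (at i p *ₚ g i) j) (coeff-monomial-above (seq b i) n<j))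
            (solve 2 (λ c x → c :* con 0ℚ :+ x := x) refl (seq c i) (coeff (at i p *ₚ g i) j))))
        (null (ℕₚ.m<n⇒m<1+n n<j))
      Null-cb : Null (λ i → seq c i * seq b i)
      Null-cb = Null-resp
        (λ i → trans (cong₂ _-_
            (trans (coeff-∷-*-suc (seq c i) (at i p) (g i) n)
              (cong (λ x → seq c i * x + coeff (at i p *ₚ g i) n) (coeff-monomial-diag (seq b i) n)))
            (cong (λ r → coeff r n) (trans (at-* i p (binomial₂ a b n)) (cong (at i p *ₚ_) (at-binomial i a b n)))))
          (solve 2 (λ x y → x :+ y :- y := x) refl (seq c i * seq b i) (coeff (at i p *ₚ g i) n)))
        (Null-+ (null (ℕₚ.n<1+n n)) (Null-neg (Null-coeff-* p (binomial₂ a b n) Null-p n)))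
      Null-c : Null (seq c)
      Null-c = Null-resp
        (λ i → solve 3 (λ b b′ c → b′ :* (c :* b) :- c :* (b :* b′ :- con 1ℚ) := c) refl (seq b i) (seq b⁻¹ i) (seq c i))
        (Null-+ (Null-* b⁻¹ Null-cb) (Null-neg (Null-* c inverse)))

    -- If q g = 1, then q g vanishes at all positive indices, so q = 0 by `Null-cancel`. Then q g =
    -- 0 too, against its constant term 1.
    binomial-nonunit : ∀ q → ¬ (q ℚ₂[x].*ₚ binomial₂ a b n ℚ₂[x].≈ₚ [ ι 1ℚ ])
    binomial-nonunit q eq = ¬Null-1 (Null-resp
      (λ i → solve 1 (λ x → x :- (x :- con 1ℚ) := con 1ℚ) refl (coeff (at i (q ℚ₂[x].*ₚ binomial₂ a b n)) 0))
      (Null-+ (Null-coeff-* q (binomial₂ a b n) (Null-cancel q (λ {j} → top {j})) 0) (Null-neg (Null-resp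
        (λ i → cong (_- 1ℚ) (sym (coeff-at i (q ℚ₂[x].*ₚ binomial₂ a b n) 0))) (eq 0)))))
      where
      open ℚ-Solver
      top : ∀ {j} → n ℕ.< j → Null (λ i → coeff (at i q *ₚ g i) j)
      top {suc j} _ = Null-resp
        (λ i → trans (ℚₚ.+-identityʳ _) (trans (sym (coeff-at i (q ℚ₂[x].*ₚ binomial₂ a b n) (suc j)))
          (cong (λ r → coeff r (suc j)) (trans (at-* i q (binomial₂ a b n)) (cong (at i q *ₚ_) (at-binomial i a b n))))))
        (eq (suc j))

  -- Both factors have positive degree and an invertible leading coefficient, so neither divides 1,
  -- whereas irreducibility would force one of them to.
  reducible : ∀ f (a b b⁻¹ a′ b′ b′⁻¹ : ℚ₂) n →
    Null (λ i → seq b i * seq b⁻¹ i - 1ℚ) → Null (λ i → seq b′ i * seq b′⁻¹ i - 1ℚ) →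
    (∀ j → Null (λ i → coeff f j - coeff (binomial (seq a i) (seq b i) n *ₚ binomial (seq a′ i) (seq b′ i) n) j)) →
    ¬ IrreducibleOverℚ₂ f
  reducible f a b b⁻¹ a′ b′ b′⁻¹ n inv inv′ factor irr =
    [ nonunit a b b⁻¹ inv , nonunit a′ b′ b′⁻¹ inv′ ]′
      (split-∣1 {binomial₂ a b n} {binomial₂ a′ b′ n} λ j → Null-resp (λ i → cong₂ _-_
        (trans (cong (λ r → coeff r j) (sym (at-ι i f))) (coeff-at i (map ι f) j))
        (trans (cong (λ r → coeff r j) (sym (trans (at-* i (binomial₂ a b n) (binomial₂ a′ b′ n))
            (cong₂ _*ₚ_ (at-binomial i a b n) (at-binomial i a′ b′ n)))))
          (coeff-at i (binomial₂ a b n ℚ₂[x].*ₚ binomial₂ a′ b′ n) j))) (factor j))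
    where
    open RawSemiringDefs (RawRing.rawSemiring ℚ₂[x].rawRing) using (Irreducible) renaming (_∣_ to _∣ₚ_)
    open RawSemiringDefs.Irreducible irr
    nonunit : ∀ a b b⁻¹ → Null (λ i → seq b i * seq b⁻¹ i - 1ℚ) → ¬ binomial₂ a b n ∣ₚ [ ι 1ℚ ]
    nonunit a b b⁻¹ inv record { quotient = q ; equality = eq } = binomial-nonunit a b b⁻¹ n inv q eq

-- Square roots in ℚ₂ and the factorization of the tested polynomials

module TwoAdicFactorizations where

  open RationalPolynomials
  open TwoAdicPolynomials
  open ℚ using (ℚ; 0ℚ; 1ℚ; ½; _+_; _*_; _-_; -_; _/_; _≤_)
  open import Data.Integer.Divisibility.Signed
  open TwoAdic using (mkCauchy; seq; ι; _⊕_; _⊗_; ⊖_)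

  int-2^ : ∀ n → int ((+ 2) ℤ.^ n) ≡ 2ℚ ^ℚ n
  int-2^ zero    = refl
  int-2^ (suc n) = trans (int-* (+ 2) ((+ 2) ℤ.^ n)) (cong (2ℚ *_) (int-2^ n))

  divisible⇒ball : ∀ n {z} → (+ 2) ℤ.^ n ∣ z → TwoAdicBall n (int z)
  divisible⇒ball n {z} (divides a z≡) = mkBall a (+ 0) (begin
    int z * 1ℚ                       ≡⟨ ℚₚ.*-identityʳ (int z) ⟩
    int z                            ≡⟨ cong int (trans z≡ (ℤₚ.*-comm a ((+ 2) ℤ.^ n))) ⟩
    int ((+ 2) ℤ.^ n ℤ.* a)          ≡⟨ int-* ((+ 2) ℤ.^ n) a ⟩
    int ((+ 2) ℤ.^ n) * int a        ≡⟨ cong (_* int a) (int-2^ n) ⟩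
    2ℚ ^ℚ n * int a                  ∎)
    where open ≡-Reasoning

  int-- : ∀ i j → int (i ℤ.- j) ≡ int i - int j
  int-- i j = begin
    int (i ℤ.- j)                    ≡⟨ int-+ i (ℤ.- j) ⟩
    int i + int (ℤ.- j)
      ≡⟨ solve 3 (λ x y z → x :+ y := (x :+ (z :+ y)) :- z) refl (int i) (int (ℤ.- j)) (int j) ⟩
    int i + (int j + int (ℤ.- j)) - int j
      ≡⟨ cong (λ x → int i + x - int j) (trans (sym (int-+ j (ℤ.- j))) (cong int (ℤₚ.+-inverseʳ j))) ⟩
    int i + 0ℚ - int j               ≡⟨ cong (_- int j) (ℚₚ.+-identityʳ (int i)) ⟩
    int i - int j                    ∎
    where
    open ≡-Reasoning
    open ℚ-Solver

  2^-∣-2^+ : ∀ m n → (+ 2) ℤ.^ n ∣ (+ 2) ℤ.^ (m ℕ.+ n)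
  2^-∣-2^+ m n = divides ((+ 2) ℤ.^ m) (ℤₚ.^-distribˡ-+-* (+ 2) m n)

  -- Hensel's lemma for x² = (1 + 2 r₀)² - 8 c₀: if x = 1 + 2 r has error x² - U = 2ⁿ⁺³ c, then x + 2ⁿ⁺² c has an
  -- error divisible by 2ⁿ⁺⁴, since 1 + x is even.
  module SquareRoot (r₀ c₀ : ℤ) where

    odd : ℤ → ℤ
    odd r = + 1 ℤ.+ + 2 ℤ.* r

    U : ℤ
    U = odd r₀ ℤ.* odd r₀ ℤ.- + 8 ℤ.* c₀

    r c : ℕ → ℤ
    r zero    = r₀
    r (suc n) = r n ℤ.+ + 2 ℤ.* (+ 2) ℤ.^ n ℤ.* c n
    c zero    = c₀
    c (suc n) = c n ℤ.* (+ 1 ℤ.+ r n) ℤ.+ (+ 2) ℤ.^ n ℤ.* (c n ℤ.* c n)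

    t : ℕ → ℤ
    t n = odd (r n)

    t²≡ : ∀ n → t n ℤ.* t n ≡ U ℤ.+ + 8 ℤ.* c n ℤ.* (+ 2) ℤ.^ n
    t²≡ zero    = solve 2 (λ x c → x := x :- con (+ 8) :* c :+ con (+ 8) :* c :* con (+ 1)) refl (odd r₀ ℤ.* odd r₀) c₀
      where open ℤ-Solver
    t²≡ (suc n) = begin
      t (suc n) ℤ.* t (suc n)
        ≡⟨ solve 3 (λ r c e →
             let oddₛ r = con (+ 1) :+ con (+ 2) :* r
                 r′     = r :+ con (+ 2) :* e :* c
             in oddₛ r′ :* oddₛ r′ := oddₛ r :* oddₛ r :+ con (+ 8) :* e :* c :* oddₛ r :+ con (+ 16) :* (e :* c) :* (e :* c))
           refl (r n) (c n) e ⟩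
      t n ℤ.* t n ℤ.+ + 8 ℤ.* e ℤ.* c n ℤ.* t n ℤ.+ + 16 ℤ.* (e ℤ.* c n) ℤ.* (e ℤ.* c n)
        ≡⟨ cong (λ x → x ℤ.+ + 8 ℤ.* e ℤ.* c n ℤ.* t n ℤ.+ + 16 ℤ.* (e ℤ.* c n) ℤ.* (e ℤ.* c n)) (t²≡ n) ⟩
      U ℤ.+ + 8 ℤ.* c n ℤ.* e ℤ.+ + 8 ℤ.* e ℤ.* c n ℤ.* t n ℤ.+ + 16 ℤ.* (e ℤ.* c n) ℤ.* (e ℤ.* c n)
        ≡⟨ solve 4 (λ U r c e →
             U :+ con (+ 8) :* c :* e :+ con (+ 8) :* e :* c :* (con (+ 1) :+ con (+ 2) :* r)
               :+ con (+ 16) :* (e :* c) :* (e :* c)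
             := U :+ con (+ 8) :* (c :* (con (+ 1) :+ r) :+ e :* (c :* c)) :* (con (+ 2) :* e))
           refl U (r n) (c n) e ⟩
      U ℤ.+ + 8 ℤ.* c (suc n) ℤ.* (+ 2) ℤ.^ suc n ∎
      where
      open ≡-Reasoning
      open ℤ-Solver
      e = (+ 2) ℤ.^ n

    t-converges : ∀ n k → (+ 2) ℤ.^ n ∣ t (k ℕ.+ n) ℤ.- t n
    t-converges n zero    = divides (+ 0) (ℤₚ.+-inverseʳ (t n))
    t-converges n (suc k) = subst ((+ 2) ℤ.^ n ∣_)
      (solve 4 (λ r c e s →
         let oddₛ r = con (+ 1) :+ con (+ 2) :* r
         in oddₛ r :- s :+ con (+ 4) :* c :* e := oddₛ (r :+ con (+ 2) :* e :* c) :- s) refl (r i) (c i) ((+ 2) ℤ.^ i) (t n))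
      (∣m∣n⇒∣m+n (t-converges n k) (∣n⇒∣m*n (+ 4 ℤ.* c i) (2^-∣-2^+ k n)))
      where
      open ℤ-Solver
      i = k ℕ.+ n

    t-converges′ : ∀ {n i} → n ℕ.≤ i → (+ 2) ℤ.^ n ∣ t i ℤ.- t n
    t-converges′ {n} n≤i with ℕₚ.m≤n⇒∃[o]m+o≡n n≤i
    ... | k , refl = subst (λ j → (+ 2) ℤ.^ n ∣ t j ℤ.- t n) (ℕₚ.+-comm k n) (t-converges n k)

    root : ℚ₂
    root = mkCauchy (int ∘ t) λ n → n , λ {i} {j} n≤i n≤j → subst (TwoAdicBall n) (int-- (t i) (t j))
      (divisible⇒ball n (subst ((+ 2) ℤ.^ n ∣_)
        (solve 3 (λ x y z → (x :- z) :- (y :- z) := x :- y) refl (t i) (t j) (t n))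
        (∣m∣n⇒∣m-n (t-converges′ n≤i) (t-converges′ n≤j))))
      where open ℤ-Solver

    root²≈U : Null (λ i → seq root i * seq root i - int U)
    root²≈U n = n , λ {i} n≤i → subst (TwoAdicBall n)
      (trans (int-- (t i ℤ.* t i) U) (cong (_- int U) (int-* (t i) (t i))))
      (divisible⇒ball n (subst ((+ 2) ℤ.^ n ∣_)
        (trans (solve 2 (λ u x → x := u :+ x :- u) refl U (+ 8 ℤ.* c i ℤ.* (+ 2) ℤ.^ i)) (cong (ℤ._- U) (sym (t²≡ i))))
        (∣n⇒∣m*n (+ 8 ℤ.* c i) (2^∣2^ n≤i))))
      where
      open ℤ-Solver
      2^∣2^ : ∀ {n i} → n ℕ.≤ i → (+ 2) ℤ.^ n ∣ (+ 2) ℤ.^ i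
      2^∣2^ {n} n≤i with ℕₚ.m≤n⇒∃[o]m+o≡n n≤i
      ... | k , refl = subst (λ j → (+ 2) ℤ.^ n ∣ (+ 2) ℤ.^ j) (ℕₚ.+-comm k n) (2^-∣-2^+ k n)

  2∤⇒odd : ∀ N → 2 ℕ∣.∤ N → ∃[ h ] + N ≡ + 1 ℤ.+ + 2 ℤ.* h
  2∤⇒odd N 2∤N with TwoAdicBallLemmas.parity N
  ... | h , inj₁ refl = contradiction (ℕ∣.m∣m*n h) 2∤N
  ... | h , inj₂ refl = + h , cong (λ x → + 1 ℤ.+ x) (ℤₚ.pos-* 2 h)

  ½^-+ : ∀ m n → ½ ^ℚ (m ℕ.+ n) ≡ ½ ^ℚ m * ½ ^ℚ n
  ½^-+ zero    n = sym (ℚₚ.*-identityˡ (½ ^ℚ n))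
  ½^-+ (suc m) n = trans (cong (½ *_) (½^-+ m n)) (sym (ℚₚ.*-assoc ½ (½ ^ℚ m) (½ ^ℚ n)))

  -- With y = x^(2k+1) and l = n + 5, the polynomials in question are (4 - s N²) y² + y + 4 and 4 y² + y + (4 - s N²)
  -- divided by N², where s = 2^(-2l). Both have discriminant U ρ² with U = N² - 63 · 2^(2l-4) ≡ 1 mod 8 and ρ = 2^(2-l).
  module Factorization (k N n : ℕ) .{{_ : NonZero N}} (2∤N : 2 ℕ∣.∤ N) where

    -- c₀ satisfies 8 c₀ = 63 · (8E)², so that U becomes N² - 63 · 2^(2n+6).
    r₀ c₀ E : ℤ
    r₀ = proj₁ (2∤⇒odd N 2∤N)
    E  = (+ 2) ℤ.^ n
    c₀ = + 63 ℤ.* + 8 ℤ.* (E ℤ.* E)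

    open SquareRoot r₀ c₀

    private
      -- Completing the square for c = 4 - s N²: 16 (4y² + y + c) = (8y + 1)² - (1 - 16c), and 1 -
      -- 16c = U ρ². With a root t of U this is (8y + 1 + ρt)(8y + 1 - ρt). κ collects 1/16 and
      -- 1/N², and P is the inverse of ρ.
      R P ρ κ w s : ℚ
      R = int (+ N)
      P = int (+ 8) * int E
      ρ = ½ ^ℚ (3 ℕ.+ n)
      w = invN² N
      κ = + 1 / 16 * w
      s = 2^ (ℤ.- (+ 2 ℤ.* + (5 ℕ.+ n)))

      ρP≡1 : ρ * P ≡ 1ℚ
      ρP≡1 = begin
        ρ * (int (+ 8) * int E)                 ≡⟨ cong (λ x → ρ * (int (+ 8) * x)) (int-2^ n) ⟩
        ρ * (int (+ 8) * 2ℚ ^ℚ n)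
          ≡⟨ solve 2 (λ ρ e → ρ :* (con (int (+ 8)) :* e) := con 2ℚ :* (con 2ℚ :* (con 2ℚ :* e)) :* ρ) refl ρ (2ℚ ^ℚ n) ⟩
        2ℚ ^ℚ (3 ℕ.+ n) * ρ                     ≡⟨ cong (λ m → 2ℚ ^ℚ (3 ℕ.+ n) * ½ ^ℚ m) (ℕₚ.+-identityʳ (3 ℕ.+ n)) ⟨
        2ℚ ^ℚ (3 ℕ.+ n) * ½ ^ℚ (3 ℕ.+ n ℕ.+ 0)  ≡⟨ RealBallLemmas.2^k*½^[k+n] (3 ℕ.+ n) 0 ⟩
        1ℚ                                      ∎
        where
        open ≡-Reasoning
        open ℚ-Solver

      s≡ : s ≡ + 1 / 16 * (ρ * ρ)
      s≡ = trans (½^-+ (5 ℕ.+ n) (5 ℕ.+ n ℕ.+ 0)) (trans (cong (λ m → ½ ^ℚ (5 ℕ.+ n) * ½ ^ℚ m) (ℕₚ.+-identityʳ (5 ℕ.+ n)))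
        (solve 1 (λ ρ → con ½ :* (con ½ :* ρ) :* (con ½ :* (con ½ :* ρ)) := con (+ 1 / 16) :* (ρ :* ρ)) refl ρ))
        where open ℚ-Solver

      wR²≡1 : w * (R * R) ≡ 1ℚ
      wR²≡1 = invN²-* N

      N≡ : + N ≡ odd r₀
      N≡ = proj₂ (2∤⇒odd N 2∤N)

      int-U : int U ≡ R * R - int (+ 63) * (P * P)
      int-U = begin
        int (odd r₀ ℤ.* odd r₀ ℤ.- + 8 ℤ.* c₀)
          ≡⟨ int-- (odd r₀ ℤ.* odd r₀) (+ 8 ℤ.* c₀) ⟩
        int (odd r₀ ℤ.* odd r₀) - int (+ 8 ℤ.* c₀)
          ≡⟨ cong₂ _-_ (trans (cong (λ x → int (x ℤ.* x)) (sym N≡)) (int-* (+ N) (+ N)))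
               (trans (int-* (+ 8) c₀) (cong (int (+ 8) *_) (trans (int-* (+ 63 ℤ.* + 8) (E ℤ.* E))
                 (cong (int (+ 63 ℤ.* + 8) *_) (int-* E E))))) ⟩
        R * R - int (+ 8) * (int (+ 63 ℤ.* + 8) * (int E * int E))
          ≡⟨ solve 2 (λ R e → R :* R :- con (int (+ 8)) :* (con (int (+ 63 ℤ.* + 8)) :* (e :* e))
               := R :* R :- con (int (+ 63)) :* (con (int (+ 8)) :* e :* (con (int (+ 8)) :* e))) refl R (int E) ⟩
        R * R - int (+ 63) * (P * P) ∎
        where
        open ≡-Reasoning
        open ℚ-Solver

      -- The constant term of the polynomial tested in 5a and the leading coefficient of the one
      -- tested in 5b.
      defect : ℚ
      defect = int (+ 4) * w - s

      -- The factorization error at an arbitrary approximation t is a fixed multiple of t² - U, so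
      -- it tends to 0 along `root`.
      key : ∀ t → defect - (1ℚ + ρ * t) * (κ * (1ℚ + - (ρ * t))) ≡ κ * (ρ * ρ) * (t * t - int U)
      key t = begin
        int (+ 4) * w - s - (1ℚ + ρ * t) * (κ * (1ℚ + - (ρ * t)))
          ≡⟨ cong (λ s → int (+ 4) * w - s - (1ℚ + ρ * t) * (κ * (1ℚ + - (ρ * t)))) s≡ ⟩
        int (+ 4) * w - + 1 / 16 * (ρ * ρ) - (1ℚ + ρ * t) * (κ * (1ℚ + - (ρ * t)))
          -- The factors 1 are placeholders: the next step replaces them by w R² and ρ P.
          ≡⟨ solve 3 (λ w ρ t → let κ = con (+ 1 / 16) :* w in
               con (int (+ 4)) :* w :- con (+ 1 / 16) :* (ρ :* ρ) :- (con 1ℚ :+ ρ :* t) :* (κ :* (con 1ℚ :+ :- (ρ :* t)))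
               := κ :* (ρ :* ρ) :* (t :* t) :- con (+ 1 / 16) :* (ρ :* ρ) :* con 1ℚ :+ con (int (+ 63)) :* κ :* (con 1ℚ :* con 1ℚ))
             refl w ρ t ⟩
        κ * (ρ * ρ) * (t * t) - + 1 / 16 * (ρ * ρ) * 1ℚ + int (+ 63) * κ * (1ℚ * 1ℚ)
          ≡⟨ cong₂ (λ x y → κ * (ρ * ρ) * (t * t) - + 1 / 16 * (ρ * ρ) * x + int (+ 63) * κ * (y * y)) wR²≡1 ρP≡1 ⟨
        κ * (ρ * ρ) * (t * t) - + 1 / 16 * (ρ * ρ) * (w * (R * R)) + int (+ 63) * κ * (ρ * P * (ρ * P))
          ≡⟨ solve 5 (λ w ρ t R P → let κ = con (+ 1 / 16) :* w in
               κ :* (ρ :* ρ) :* (t :* t) :- con (+ 1 / 16) :* (ρ :* ρ) :* (w :* (R :* R)) :+ con (int (+ 63)) :* κ :* (ρ :* P :* (ρ :* P))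
               := κ :* (ρ :* ρ) :* (t :* t :- (R :* R :- con (int (+ 63)) :* (P :* P)))) refl w ρ t R P ⟩
        κ * (ρ * ρ) * (t * t - (R * R - int (+ 63) * (P * P)))
          ≡⟨ cong (λ x → κ * (ρ * ρ) * (t * t - x)) int-U ⟨
        κ * (ρ * ρ) * (t * t - int U) ∎
        where
        open ≡-Reasoning
        open ℚ-Solver

      -- Clearing denominators in 4/N² = 2^(-2l) with l = n + 5 gives N² = 2^(2n+12) = 4096 E².
      defect≡0⇒N²-even : defect ≡ 0ℚ → int (+ 2048 ℤ.* E ℤ.* E ℤ.* + 2) ≡ int (+ N ℤ.* + N)
      defect≡0⇒N²-even defect≡0 = begin
        int (+ 2048 ℤ.* E ℤ.* E ℤ.* + 2)
          ≡⟨ trans (int-* (+ 2048 ℤ.* E ℤ.* E) (+ 2)) (cong (_* 2ℚ) (trans (int-* (+ 2048 ℤ.* E) E) (cong (_* int E) (int-* (+ 2048) E)))) ⟩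
        int (+ 2048) * int E * int E * 2ℚ
          ≡⟨ solve 2 (λ e ρ → con (int (+ 2048)) :* e :* e :* con 2ℚ
               := con (int (+ 64)) :* (con (int (+ 8)) :* e :* (con (int (+ 8)) :* e)) :* con 1ℚ) refl (int E) ρ ⟩
        int (+ 64) * (P * P) * 1ℚ
          ≡⟨ cong (int (+ 64) * (P * P) *_) wR²≡1 ⟨
        int (+ 64) * (P * P) * (w * (R * R))
          ≡⟨ solve 5 (λ w R P ρ s → con (int (+ 64)) :* (P :* P) :* (w :* (R :* R))
               := (con (int (+ 4)) :* w :- s :+ s) :* (con (int (+ 16)) :* (P :* P) :* (R :* R))) refl w R P ρ s ⟩
        (defect + s) * (int (+ 16) * (P * P) * (R * R))
          ≡⟨ cong₂ (λ x y → (x + y) * (int (+ 16) * (P * P) * (R * R))) defect≡0 s≡ ⟩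
        (0ℚ + + 1 / 16 * (ρ * ρ)) * (int (+ 16) * (P * P) * (R * R))
          ≡⟨ solve 3 (λ ρ P R → (con 0ℚ :+ con (+ 1 / 16) :* (ρ :* ρ)) :* (con (int (+ 16)) :* (P :* P) :* (R :* R))
               := ρ :* P :* (ρ :* P) :* (R :* R)) refl ρ P R ⟩
        ρ * P * (ρ * P) * (R * R)
          ≡⟨ cong (λ x → x * x * (R * R)) ρP≡1 ⟩
        1ℚ * 1ℚ * (R * R)
          ≡⟨ ℚₚ.*-identityˡ (R * R) ⟩
        R * R
          ≡⟨ int-* (+ N) (+ N) ⟨
        int (+ N ℤ.* + N) ∎
        where
        open ≡-Reasoning
        open ℚ-Solver

      defect≢0 : defect ≢ 0ℚ
      defect≢0 defect≡0 = 2∤odd (r₀ ℤ.+ r₀ ℤ.+ + 2 ℤ.* (r₀ ℤ.* r₀)) (subst (+ 2 ∣_)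
        (trans (int-injective (defect≡0⇒N²-even defect≡0)) (trans (cong₂ ℤ._*_ N≡ N≡) (solve 1 (λ r →
          (con (+ 1) :+ con (+ 2) :* r) :* (con (+ 1) :+ con (+ 2) :* r) := con (+ 1) :+ con (+ 2) :* (r :+ r :+ con (+ 2) :* (r :* r))) refl r₀)))
        (∣n⇒∣m*n (+ 2048 ℤ.* E ℤ.* E) ∣-refl))
        where
        open ℤ-Solver

      instance
        defect-nonZero : ℚ.NonZero defect
        defect-nonZero = ℚ.≢-nonZero defect≢0

      -- The factors are u + 8y and κv + 8κy in 5a, and their reversals 8 + u y and 8κ + κv y in 5b.
      u v κv : ℚ₂
      u  = ι 1ℚ ⊕ (ι ρ ⊗ root)
      v  = ι 1ℚ ⊕ (⊖ (ι ρ ⊗ root))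
      κv = ι κ ⊗ v

      uκv≈defect : Null (λ i → defect - seq u i * seq κv i)
      uκv≈defect = Null-resp (λ i → sym (key (seq root i))) (Null-scale (κ * (ρ * ρ)) root²≈U)

      -- The product of u and κv is the nonzero rational `defect`, so each is the inverse of the
      -- other up to 1/`defect`. This inverts both leading coefficients in 5b.
      uκv-inverse : Null (λ i → seq u i * (ℚ.1/ defect * seq κv i) - 1ℚ)
      uκv-inverse = Null-resp (λ i → begin
          - (ℚ.1/ defect * (defect - seq u i * seq κv i))
            ≡⟨ solve 4 (λ d d′ u v → :- (d′ :* (d :- u :* v)) := u :* (d′ :* v) :- d :* d′) refl defect (ℚ.1/ defect) (seq u i) (seq κv i) ⟩
          seq u i * (ℚ.1/ defect * seq κv i) - defect * ℚ.1/ defect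
            ≡⟨ cong (λ x → seq u i * (ℚ.1/ defect * seq κv i) - x) (ℚₚ.*-inverseʳ defect) ⟩
          seq u i * (ℚ.1/ defect * seq κv i) - 1ℚ ∎)
        (Null-neg (Null-scale (ℚ.1/ defect) uκv≈defect))
        where
        open ≡-Reasoning
        open ℚ-Solver

      8ℚ 1/8 : ℚ
      8ℚ  = int (+ 8)
      1/8 = + 1 / 8

      constant-Null : ∀ {q} → q ≡ 1ℚ → Null (λ _ → q - 1ℚ)
      constant-Null refl = Null-0

    ¬irreducible₁ : ¬ IrreducibleOverℚ₂ (f[ k , N ] -ₚ monomial s 0)
    ¬irreducible₁ = reducible (f[ k , N ] -ₚ monomial s 0) u (ι 8ℚ) (ι 1/8) κv (ι (8ℚ * κ)) (ι (2ℚ * (R * R))) (k ℕ.* 2)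
      (constant-Null refl)
      (constant-Null (trans (solve 2 (λ w R → con 8ℚ :* (con (+ 1 / 16) :* w) :* (con 2ℚ :* (R :* R)) := w :* (R :* R)) refl w R) wR²≡1))
      λ j → Null-resp (λ i → sym (difference j i)) (Null-scale (int (δ 0 j)) uκv≈defect)
      where
      open ℚ-Solver
      difference : ∀ j i → coeff (f[ k , N ] -ₚ monomial s 0) j
        - coeff (binomial (seq u i) 8ℚ (k ℕ.* 2) *ₚ binomial (seq κv i) (8ℚ * κ) (k ℕ.* 2)) j
        ≡ int (δ 0 j) * (defect - seq u i * seq κv i)
      difference j i = trans (cong₂ _-_
          (trans (coeff-+ f[ k , N ] _ j) (cong₂ _+_ (coeff-f N k j)
            (trans (coeff-map-neg (monomial s 0) j) (cong -_ (coeff-monomial s 0 j)))))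
          (coeff-binomial-* (seq u i) 8ℚ (seq κv i) (8ℚ * κ) (k ℕ.* 2) j))
        (solve 7 (λ w s x t a b c →
          let κ = con (+ 1 / 16) :* w
              u = con 1ℚ :+ x :* t
              v = κ :* (con 1ℚ :+ :- (x :* t))
          in (con (int (+ 4)) :* w :* a :+ w :* b :+ con (int (+ 4)) :* w :* c) :+ :- (s :* c)
             :- (con 8ℚ :* (con 8ℚ :* κ) :* a :+ (u :* (con 8ℚ :* κ) :+ con 8ℚ :* v) :* b :+ u :* v :* c)
             := c :* (con (int (+ 4)) :* w :- s :- u :* v))
          refl w s ρ (seq root i) (int (δ (suc (k ℕ.* 2) ℕ.* 2) j)) (int (δ (suc (k ℕ.* 2)) j)) (int (δ 0 j)))

    ¬irreducible₂ : ¬ IrreducibleOverℚ₂ (f[ k , N ] -ₚ monomial s (2 ℕ.* (2 ℕ.* k ℕ.+ 1)))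
    ¬irreducible₂ = reducible (f[ k , N ] -ₚ monomial s d) (ι 8ℚ) u (ι (ℚ.1/ defect) ⊗ κv) (ι (8ℚ * κ)) κv (ι (ℚ.1/ defect) ⊗ u) (k ℕ.* 2)
      uκv-inverse
      (Null-resp (λ i → solve 3 (λ d u v → u :* (d :* v) :- con 1ℚ := v :* (d :* u) :- con 1ℚ) refl (ℚ.1/ defect) (seq u i) (seq κv i)) uκv-inverse)
      λ j → Null-resp (λ i → sym (difference j i)) (Null-scale (int (δ (suc (k ℕ.* 2) ℕ.* 2) j)) uκv≈defect)
      where
      open ℚ-Solver
      d = 2 ℕ.* (2 ℕ.* k ℕ.+ 1)
      d≡ : d ≡ suc (k ℕ.* 2) ℕ.* 2
      d≡ = trans (ℕₚ.*-comm 2 (2 ℕ.* k ℕ.+ 1)) (cong (ℕ._* 2) (trans (ℕₚ.+-comm (2 ℕ.* k) 1) (cong suc (ℕₚ.*-comm 2 k))))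
      difference : ∀ j i → coeff (f[ k , N ] -ₚ monomial s d) j
        - coeff (binomial 8ℚ (seq u i) (k ℕ.* 2) *ₚ binomial (8ℚ * κ) (seq κv i) (k ℕ.* 2)) j
        ≡ int (δ (suc (k ℕ.* 2) ℕ.* 2) j) * (defect - seq u i * seq κv i)
      difference j i = trans (cong₂ _-_
          (trans (coeff-+ f[ k , N ] _ j) (cong₂ _+_ (coeff-f N k j)
            (trans (coeff-map-neg (monomial s d) j) (cong -_ (trans (coeff-monomial s d j) (cong (λ e → s * int (δ e j)) d≡))))))
          (coeff-binomial-* 8ℚ (seq u i) (8ℚ * κ) (seq κv i) (k ℕ.* 2) j))
        (solve 7 (λ w s x t a b c →
          let κ = con (+ 1 / 16) :* w
              u = con 1ℚ :+ x :* t
              v = κ :* (con 1ℚ :+ :- (x :* t))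
          in (con (int (+ 4)) :* w :* a :+ w :* b :+ con (int (+ 4)) :* w :* c) :+ :- (s :* a)
             :- (u :* v :* a :+ (con 8ℚ :* v :+ u :* (con 8ℚ :* κ)) :* b :+ con 8ℚ :* (con 8ℚ :* κ) :* c)
             := a :* (con (int (+ 4)) :* w :- s :- u :* v))
          refl w s ρ (seq root i) (int (δ (suc (k ℕ.* 2) ℕ.* 2) j)) (int (δ (suc (k ℕ.* 2)) j)) (int (δ 0 j)))

-- The loop starts at l ≥ 5 and no run ends

module Runs where

  open RationalPolynomials
  open SumsOfFourSquares
  open TwoAdicFactorizations
  open ℚ using (ℚ; 0ℚ; 1ℚ; ½; _+_; _*_; _-_; -_; _/_; _≤_)

  seq-eval-≡0 : ∀ p x i → Real.seq x i ≡ 0ℚ → Real.seq (eval p x) i ≡ coeff p 0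
  seq-eval-≡0 []      x i x≡0 = refl
  seq-eval-≡0 (a ∷ p) x i x≡0 = begin
    a + Real.seq x i * y     ≡⟨ cong (λ z → a + z * y) x≡0 ⟩
    a + 0ℚ * y               ≡⟨ cong (λ z → a + z) (ℚₚ.*-zeroˡ y) ⟩
    a + 0ℚ                   ≡⟨ ℚₚ.+-identityʳ a ⟩
    a                        ∎
    where
    open ≡-Reasoning
    y : ℚ
    y = Real.seq (eval p x) i

  ∣p-q∣≤r⇒p≤q+r : ∀ {p q r} → ℚ.∣ p - q ∣ ≤ r → p ≤ q + r
  ∣p-q∣≤r⇒p≤q+r {p} {q} {r} h = subst (_≤ q + r) (solve 2 (λ p q → q :+ (p :- q) := p) refl p q)
    (ℚₚ.+-monoʳ-≤ q (ℚₚ.≤-trans (p≤∣p∣ (p - q)) h))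
    where
    open ℚ-Solver
    p≤∣p∣ : ∀ p → p ≤ ℚ.∣ p ∣
    p≤∣p∣ (ℚ.mkℚ (+ _)    _ _) = ℚₚ.≤-refl
    p≤∣p∣ (ℚ.mkℚ -[1+ _ ] _ _) = ℚ.*≤* ℤ.-≤+

  int-mono-≤ : ∀ {i j} → i ℤ.≤ j → int i ≤ int j
  int-mono-≤ {i} {j} i≤j = ℚₚ.toℚᵘ-cancel-≤ (begin
    ℚ.toℚᵘ (int i)      ≃⟨ ℚₚ.toℚᵘ-fromℚᵘ (ℚᵘ.mkℚᵘ i 0) ⟩
    ℚᵘ.mkℚᵘ i 0         ≤⟨ ℚᵘ.*≤* (ℤₚ.*-monoʳ-≤-nonNeg (+ 1) i≤j) ⟩
    ℚᵘ.mkℚᵘ j 0         ≃⟨ ℚₚ.toℚᵘ-fromℚᵘ (ℚᵘ.mkℚᵘ j 0) ⟨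
    ℚ.toℚᵘ (int j)      ∎)
    where open ℚᵘₚ.≤-Reasoning

  <ᴿ-≤-trans : ∀ {x p q} → x <ᴿ Real.ι p → p ≤ q → x <ᴿ Real.ι q
  <ᴿ-≤-trans (n , M , h) p≤q = n , M , λ M≤i → ℚₚ.≤-trans (h M≤i) p≤q

  ½^-antitone : ∀ {m n} → m ℕ.≤ n → ½ ^ℚ n ≤ ½ ^ℚ m
  ½^-antitone {m} m≤n with ℕₚ.m≤n⇒∃[o]m+o≡n m≤n
  ... | n , refl = subst₂ _≤_ (sym (½^-+ m n)) (ℚₚ.*-identityʳ (½ ^ℚ m))
    (ℚₚ.*-monoˡ-≤-nonNeg (½ ^ℚ m) {{ℚ.nonNegative (RealBallLemmas.½^-nonNeg m)}} (RealBallLemmas.½^-≤1 n))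

  ½^-pos : ∀ n → 0ℚ ℚ.< ½ ^ℚ n
  ½^-pos zero    = ℚₚ.positive⁻¹ 1ℚ
  ½^-pos (suc n) = subst (ℚ._< ½ * ½ ^ℚ n) (ℚₚ.*-zeroʳ ½) (ℚₚ.*-monoʳ-<-pos ½ (½^-pos n))

  *-bound : ∀ w {c d h q} → 0ℚ ≤ w → 0ℚ ≤ h → d ≡ c * h → c ≤ q → w * q ≡ 1ℚ → w * d ≤ h
  *-bound w {c} {d} {h} {q} 0≤w 0≤h d≡c*h c≤q w*q≡1 = begin
    w * d          ≡⟨ cong (λ x → w * x) d≡c*h ⟩
    w * (c * h)    ≡⟨ ℚₚ.*-assoc w c h ⟨
    w * c * h      ≤⟨ ℚₚ.*-monoʳ-≤-nonNeg h {{ℚ.nonNegative 0≤h}} (ℚₚ.*-monoˡ-≤-nonNeg w {{ℚ.nonNegative 0≤w}} c≤q) ⟩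
    w * q * h      ≡⟨ cong (_* h) w*q≡1 ⟩
    1ℚ * h         ≡⟨ ℚₚ.*-identityˡ h ⟩
    h              ∎
    where open ℚₚ.≤-Reasoning

  -- 4 = 64² / 2¹⁰, so the bound N > 64 gives 4/N² ≤ 2⁻¹⁰.
  f[0]≤½^10 : ∀ k N .{{_ : NonZero N}} → 64 ℕ.< N → coeff f[ k , N ] 0 ≤ ½ ^ℚ 10
  f[0]≤½^10 k N 64<N = subst (_≤ ½ ^ℚ 10) (sym (trans (coeff-f N k 0) (simplify (int (+ 4)) (invN² N))))
    (*-bound (invN² N) {c = int (+ 64 ℤ.* + 64)} 0≤w (RealBallLemmas.½^-nonNeg 10) refl 64²≤N² (invN²-* N))
    where
    open ℚ-Solver
    instance N²≢0 = ℕₚ.m^n≢0 N 2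
    simplify : ∀ c w → c * w * 0ℚ + w * 0ℚ + c * w * 1ℚ ≡ w * c
    simplify = solve 2 (λ c w → c :* w :* con 0ℚ :+ w :* con 0ℚ :+ c :* w :* con 1ℚ := w :* c) refl
    0≤w : 0ℚ ≤ invN² N
    0≤w = ℚₚ.nonNegative⁻¹ (invN² N) {{ℚₚ.normalize-nonNeg 1 (N ℕ.^ 2)}}
    64≤N : + 64 ℤ.≤ + N
    64≤N = ℤ.+≤+ (ℕₚ.<⇒≤ 64<N)
    64²≤N² : int (+ 64 ℤ.* + 64) ≤ N² N
    64²≤N² = subst (int (+ 64 ℤ.* + 64) ≤_) (int-* (+ N) (+ N)) (int-mono-≤ {+ 64 ℤ.* + 64} {+ N ℤ.* + N}
      (ℤₚ.≤-trans (ℤₚ.*-monoʳ-≤-nonNeg (+ 64) 64≤N) (ℤₚ.*-monoˡ-≤-nonNeg (+ N) 64≤N)))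

  -- `m ≤ᴿ eval p x` is only a negation, so a rational approximation of m is compared with 2^(-1-j).
  -- If it is at least that, p(0) + 2^(-3-j) stays below m, which is a contradiction. Otherwise m
  -- stays below 2^(-j), and so does e with a margin. The factor 4 between hypothesis and conclusion
  -- leaves room for the approximation error.
  <ᴿ-≤ᴿ-value-at-0 : ∀ j p x → (∀ i → Real.seq x i ≡ 0ℚ) → ∀ e m → e <ᴿ m → m ≤ᴿ eval p x →
                     coeff p 0 ≤ ½ ^ℚ (2 ℕ.+ j) → e <ᴿ Real.ι (½ ^ℚ j)
  <ᴿ-≤ᴿ-value-at-0 j p x x≡0 e m (n , M₁ , e+½^n≤m) m≤px p0≤ = compare (4d ℚₚ.≤? Real.seq m M₂)
    where
    open ℚₚ.≤-Reasoning
    open ℚ-Solver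
    d 2d 4d : ℚ
    d  = ½ ^ℚ (3 ℕ.+ j)
    2d = ½ ^ℚ (2 ℕ.+ j)
    4d = ½ ^ℚ (1 ℕ.+ j)
    M₂ : ℕ
    M₂ = proj₁ (Real.cauchy m (3 ℕ.+ j))
    close : ∀ {i i′} → M₂ ℕ.≤ i → M₂ ℕ.≤ i′ → ℚ.∣ Real.seq m i - Real.seq m i′ ∣ ≤ d
    close = proj₂ (Real.cauchy m (3 ℕ.+ j))
    px≤ : ∀ i → Real.seq (eval p x) i + d ≤ 4d - d
    px≤ i = begin
      Real.seq (eval p x) i + d   ≡⟨ cong (_+ d) (seq-eval-≡0 p x i (x≡0 i)) ⟩
      coeff p 0 + d               ≤⟨ ℚₚ.+-monoˡ-≤ d p0≤ ⟩
      2d + d                      ≡⟨ solve 2 (λ x y → x :+ y := x :+ (y :+ y) :- y) refl 2d d ⟩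
      2d + (d + d) - d            ≡⟨ cong (λ y → 2d + y - d) (RealBallLemmas.½^-half (2 ℕ.+ j)) ⟩
      2d + 2d - d                 ≡⟨ cong (_- d) (RealBallLemmas.½^-half (1 ℕ.+ j)) ⟩
      4d - d                      ∎
    m≤m+d-d : ∀ {q i} → q ≤ Real.seq m i + d → q - d ≤ Real.seq m i
    m≤m+d-d {q} {i} q≤ = subst (q - d ≤_) (solve 2 (λ x y → x :+ y :- y := x) refl (Real.seq m i) d) (ℚₚ.+-monoˡ-≤ (- d) q≤)
    compare : Dec (4d ≤ Real.seq m M₂) → e <ᴿ Real.ι (½ ^ℚ j)
    compare (yes 4d≤m) = contradiction (3 ℕ.+ j , M₂ , λ {i} M₂≤i → ℚₚ.≤-trans (px≤ i)
      (m≤m+d-d (ℚₚ.≤-trans 4d≤m (∣p-q∣≤r⇒p≤q+r (close ℕₚ.≤-refl M₂≤i))))) m≤px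
    compare (no 4d≰m)  = n , M₁ ℕ.⊔ M₂ , λ {i} M≤i → begin
      Real.seq e i + ½ ^ℚ n       ≤⟨ e+½^n≤m (ℕₚ.m⊔n≤o⇒m≤o M₁ M₂ M≤i) ⟩
      Real.seq m i                ≤⟨ ∣p-q∣≤r⇒p≤q+r (close (ℕₚ.m⊔n≤o⇒n≤o M₁ M₂ M≤i) ℕₚ.≤-refl) ⟩
      Real.seq m M₂ + d
        ≤⟨ ℚₚ.+-mono-≤ (ℚₚ.<⇒≤ (ℚₚ.≰⇒> 4d≰m)) (½^-antitone (ℕₚ.+-monoˡ-≤ j (ℕ.s≤s {0} {2} ℕ.z≤n))) ⟩
      4d + 4d                     ≡⟨ RealBallLemmas.½^-half j ⟩
      ½ ^ℚ j                      ∎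

  module Run (k N : ℕ) .{{_ : NonZero N}} (2∤N : 2 ℕ∣.∤ N) (64<N : 64 ℕ.< N) (ε : ℝ) where

    open Reduction (2 ℕ.* (2 ℕ.* k ℕ.+ 1)) f[ k , N ] ε

    -- A factor 4 is given away against 2⁻¹⁰. The bound 2⁻⁸ still excludes l ≤ 4, because 2^(-2l) ≤
    -- ε.
    ε<½^8 : ε <inf f[ k , N ] → ε <ᴿ Real.ι (½ ^ℚ 8)
    ε<½^8 (m , (m≤f , _) , ε<m) =
      <ᴿ-≤ᴿ-value-at-0 8 f[ k , N ] (Real.ι 0ℚ) (λ _ → refl) ε m ε<m (m≤f (Real.ι 0ℚ)) (f[0]≤½^10 k N 64<N)

    module _ (ε>0 : Real.ι 0ℚ <ᴿ ε) (ε<inf : ε <inf f[ k , N ]) where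

      5≤ : ∀ {l} → l ≥-½logε → ∃[ n ] l ≡ + (5 ℕ.+ n)
      5≤ {l} l≥ = helper l λ ½^8≤ → l≥ (<ᴿ-≤-trans {ε} (ε<½^8 ε<inf) ½^8≤)
        where
        helper : ∀ l → ¬ ½ ^ℚ 8 ≤ 2^ (ℤ.- (+ 2 ℤ.* l)) → ∃[ n ] l ≡ + (5 ℕ.+ n)
        helper (+ 0) ≰ = contradiction (½^-antitone (ℕₚ.m≤m+n 0 8)) ≰
        helper (+ 1) ≰ = contradiction (½^-antitone (ℕₚ.m≤m+n 2 6)) ≰
        helper (+ 2) ≰ = contradiction (½^-antitone (ℕₚ.m≤m+n 4 4)) ≰
        helper (+ 3) ≰ = contradiction (½^-antitone (ℕₚ.m≤m+n 6 2)) ≰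
        helper (+ 4) ≰ = contradiction (½^-antitone (ℕₚ.m≤m+n 8 0)) ≰
        helper (+ suc (suc (suc (suc (suc n))))) _ = n , refl
        helper (-[1+ n ]) ≰ = contradiction (ℚₚ.≤-trans (½^-antitone (ℕₚ.m≤m+n 0 8)) (RealBallLemmas.1≤2^ (2 ℕ.* suc n))) ≰

      -- Positivity puts some 2⁻ⁿ below ε, and 2^(-2n) ≤ 2⁻ⁿ.
      ∃≥-½logε : ∃[ n ] (+ n) ≥-½logε
      ∃≥-½logε = let (n , M , ½^n≤ε) = ε>0 in n , λ (n′ , M′ , ε+≤) → ℚₚ.<-irrefl refl (ℚₚ.<-≤-trans (½^-pos n′) (+-cancelˡ-≤ (begin
          ½ ^ℚ n + ½ ^ℚ n′
            ≡⟨ cong (_+ ½ ^ℚ n′) (ℚₚ.+-identityˡ (½ ^ℚ n)) ⟨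
          0ℚ + ½ ^ℚ n + ½ ^ℚ n′
            ≤⟨ ℚₚ.+-monoˡ-≤ (½ ^ℚ n′) (½^n≤ε (ℕₚ.m≤m⊔n M M′)) ⟩
          Real.seq ε (M ℕ.⊔ M′) + ½ ^ℚ n′
            ≤⟨ ε+≤ (ℕₚ.m≤n⊔m M M′) ⟩
          2^ (ℤ.- (+ 2 ℤ.* + n))
            ≡⟨ 2^-2n n ⟩
          ½ ^ℚ (n ℕ.+ (n ℕ.+ 0))
            ≤⟨ ½^-antitone (ℕₚ.m≤m+n n (n ℕ.+ 0)) ⟩
          ½ ^ℚ n ∎)))
        where
        open ℚₚ.≤-Reasoning
        2^-2n : ∀ n → 2^ (ℤ.- (+ 2 ℤ.* + n)) ≡ ½ ^ℚ (2 ℕ.* n)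
        2^-2n zero    = refl
        2^-2n (suc n) = refl
        +-cancelˡ-≤ : ∀ {p q} → p + q ≤ p → q ≤ 0ℚ
        +-cancelˡ-≤ {p} {q} h = subst₂ _≤_ (solve 2 (λ p q → :- p :+ (p :+ q) := q) refl p q) (ℚₚ.+-inverseˡ p)
          (ℚₚ.+-monoʳ-≤ (- p) h)
          where open ℚ-Solver

      -- Without a least candidate, induction on n shows that every candidate is at least n, since a
      -- candidate equal to n would be least. The candidate from `∃≥-½logε` would then exceed
      -- itself.
      ¬¬∃⌈-½logε⌉ : ¬ ¬ (∃[ l ] Is⌈-½logε⌉ l)
      ¬¬∃⌈-½logε⌉ ∄l = let (n , n≥) = ∃≥-½logε in ℤₚ.<-irrefl refl (ℤₚ.suc[i]≤j⇒i<j (below (suc n) (+ n) n≥))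
        where
        below : ∀ n j → j ≥-½logε → + n ℤ.≤ j
        below zero    j j≥ = subst (+ 0 ℤ.≤_) (sym (proj₂ (5≤ j≥))) (ℤ.+≤+ ℕ.z≤n)
        below (suc n) j j≥ = ℤₚ.i<j⇒suc[i]≤j (ℤₚ.≤∧≢⇒< (below n j j≥)
          λ { refl → ∄l (+ n , j≥ , below n) })

      -- The invariant of reachable states: no `return`, and a loop index of the form that
      -- `Factorization` handles.
      data Running : State → Set where
        start : Running start
        loop  : ∀ n → Running (loop (+ (5 ℕ.+ n)))

      running-step : ∀ {s t} → Running s → s ⟶ t → Running t
      running-step start    (step-1 Σ²)           = ⊥-elim (¬SumOfFourSquares-f k N Σ²)
      running-step start    (step-2-4 _ (l≥ , _)) = let (n , l≡) = 5≤ l≥ in subst (λ l → Running (loop l)) (sym l≡) (loop n)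
      running-step (loop n) (step-5a irr)         = ⊥-elim (Factorization.¬irreducible₁ k N n 2∤N irr)
      running-step (loop n) (step-5b _ irr)       = ⊥-elim (Factorization.¬irreducible₂ k N n 2∤N irr)
      running-step (loop n) (step-5c _ _)         = loop (suc n)

      running-not-normal : ∀ {s} → Running s → ¬ IsNormalForm _⟶_ s
      running-not-normal start    nf = ¬¬∃⌈-½logε⌉ λ (l , l≡) → nf (loop l , step-2-4 (¬SumOfFourSquares-f k N) l≡)
      running-not-normal (loop n) nf = nf (_ , step-5c (Factorization.¬irreducible₁ k N n 2∤N) (Factorization.¬irreducible₂ k N n 2∤N))

      running-star : ∀ {s t} → Running s → Star _⟶_ s t → Running t
      running-star run Star.ε        = run
      running-star run (step ◅ rest) = running-star (running-step run step) rest

open import Data.Nat.Base using (_+_; _*_; _<_)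
open import Data.Nat.Divisibility using (_∤_)

theorem1p1 : (k N : ℕ) .{{_ : NonZero N}} → 2 ∤ N → 64 < N → (ε : ℝ) →
    Reduction.Admissible (2 * (2 * k + 1)) f[ k , N ] ε →
    ¬ Reduction.Stops (2 * (2 * k + 1)) f[ k , N ] ε
theorem1p1 k N 2∤N 64<N ε (ε>0 , ε<inf , _) (s , nf , steps) =
  running-not-normal ε>0 ε<inf (running-star ε>0 ε<inf start steps) nf
  where open Runs.Run k N 2∤N 64<N ε
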